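{- For every integer $n\ge 3$, the set $\{f(P(n),M): M\in\mathcal{M}_1(P(n))\}$ is continuous, i.e. it is an interval of integers: if $a<t<b$ are integers with $a,b$ in the set, then $t$ is in the set.
   Context: For $n\ge 3$, $P(n)=P(n,2)$ is the simple graph with vertex set $\{u_i,v_i:0\le i\le n-1\}$ and edge set $\{u_iu_{i+2},\,u_iv_i,\,v_iv_{i+1}:0\le i\le n-1\}$, subscripts modulo $n$. The edges $u_iv_i$ are called spokes. For a perfect matching $M$ of a graph $G$, a forcing set of $M$ is a subset $S\subseteq M$ contained in no perfect matching of $G$ other than $M$; the forcing number $f(G,M)$ is the minimum cardinality of a forcing set of $M$. For $n\neq 4$, $\mathcal{M}_1(P(n))$ is the set of perfect matchings $M$ of $P(n)$ such that either (i) $M$ contains at least one spoke, and for any two (cyclically) consecutive spokes $u_iv_i,u_jv_j$ of $M$ the number of spokes $u_kv_k$ of $P(n)$ strictly between them, $j-i-1$ (with $j$ taken as the representative in $(i,i+n]$), is $\equiv 0\pmod 4$ (if $M$ has exactly one spoke $u_iv_i$, it is regarded as two consecutive spokes with $j=i+n$, so the number is $n-1$); or (ii) $M$ contains no spoke, $4\mid n$, and for some $i$, $M=\bigcup_{k=0}^{n/4-1}\{u_{i+4k}u_{i+4k+2},\,u_{i+4k+1}u_{i+4k+3},\,v_{i+4k}v_{i+4k+1},\,v_{i+4k+2}v_{i+4k+3}\}$. For $n=4$, $\mathcal{M}_1(P(4))$ consists of the two perfect matchings $\{u_iv_i:0\le i\le 3\}$ and $\{u_0u_2,u_1u_3,v_0v_1,v_2v_3\}$.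 -}

module Defs where

open import Data.Bool.Base using (Bool; T)
open import Data.Fin.Base using (Fin; toℕ)
open import Data.Fin.Properties using (toℕ-fromℕ<)
open import Data.List.Base
  using (List; []; _∷_; _++_; map; length; filterᵇ; concatMap; upTo; allFin)
open import Data.List.Membership.Propositional using (_∈_)
open import Data.List.Membership.Propositional.Properties
  using (∈-map⁺; ∈-map⁻; ∈-++⁺ˡ; ∈-++⁺ʳ; ∈-allFin)
open import Data.List.Relation.Unary.All as All using (All; []; _∷_)
open import Data.List.Relation.Unary.All.Properties as All using ()
open import Data.List.Relation.Unary.Unique.Propositional using (Unique)
open import Data.List.Relation.Unary.Unique.Propositional.Properties
  using (map⁺; ++⁺; allFin⁺)
open import Data.Nat.Base
  using (ℕ; NonZero; >-nonZero; _+_; _*_; _∸_; _≤_; _<_; z≤n; s≤s)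
open import Data.Nat.DivMod
  using (_mod_; _/_; _%_; m%n<n; m≡m%n+[m/n]*n; [m+kn]%n≡m%n; m<n⇒m%n≡m; m≤n⇒[n∸m]%m≡n%m)
open import Data.Nat.Divisibility using (_∣_)
open import Data.Nat.Properties
open import Data.Nat.Tactic.RingSolver using (solve-∀)
open import Data.Product using (_×_; _,_; proj₁; proj₂; uncurry; ∃!; ∃-syntax)
open import Data.Sum.Base using (_⊎_; inj₁; inj₂; swap)
open import Function.Bundles using (_⇔_)
open import Level using (0ℓ)
open import Relation.Binary.Core using (Rel)
open import Relation.Binary.Definitions using (Symmetric; Irreflexive)
open import Relation.Binary.PropositionalEquality
open import Relation.Nullary using (¬_; yes; no)
open import Relation.Unary using (Pred)

-- The list `vertices` enumerates every vertex exactly once; it is what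
-- makes cardinalities of edge sets computable.
record FiniteSimpleGraph : Set₁ where
  infix 4 _~_
  field
    Vertex   : Set
    _~_      : Rel Vertex 0ℓ
    ~-sym    : Symmetric _~_
    ~-irrefl : Irreflexive _≡_ _~_
    vertices : List Vertex
    complete : ∀ x → x ∈ vertices
    unique   : Unique vertices

-- Every unordered pair of entries at distinct positions, listed once.
unorderedPairs : {A : Set} → List A → List (A × A)
unorderedPairs []       = []
unorderedPairs (x ∷ xs) = map (x ,_) xs ++ unorderedPairs xs

-- The symmetric relation whose unordered edges are the listed pairs.
edgesOf : {A : Set} → List (A × A) → Rel A 0ℓ
edgesOf es x y = (x , y) ∈ es ⊎ (y , x) ∈ es

module Forcing (G : FiniteSimpleGraph) where
  open FiniteSimpleGraph G

  -- A set of (undirected) edges of G, as a symmetric Boolean relation.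
  record EdgeSet : Set where
    field
      has     : Vertex → Vertex → Bool
      has-sym : ∀ {x y} → T (has x y) → T (has y x)
      has⇒~   : ∀ {x y} → T (has x y) → x ~ y
  open EdgeSet public

  infix 4 _–_∈ₑ_ _⊆ₑ_ _≐ₑ_ _≐[_]

  _–_∈ₑ_ : Vertex → Vertex → EdgeSet → Set
  x – y ∈ₑ S = T (has S x y)

  _⊆ₑ_ : Rel EdgeSet 0ℓ
  S ⊆ₑ S′ = ∀ {x y} → x – y ∈ₑ S → x – y ∈ₑ S′

  _≐ₑ_ : Rel EdgeSet 0ℓ
  S ≐ₑ S′ = S ⊆ₑ S′ × S′ ⊆ₑ S

  _≐[_] : EdgeSet → List (Vertex × Vertex) → Set
  S ≐[ es ] = ∀ x y → x – y ∈ₑ S ⇔ edgesOf es x y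

  card : EdgeSet → ℕ
  card S = length (filterᵇ (uncurry (has S)) (unorderedPairs vertices))

  IsPerfectMatching : Pred EdgeSet 0ℓ
  IsPerfectMatching M = ∀ x → ∃! _≡_ λ y → x – y ∈ₑ M

  IsForcingSet : EdgeSet → Pred EdgeSet 0ℓ
  IsForcingSet M S =
    S ⊆ₑ M × (∀ M′ → IsPerfectMatching M′ → S ⊆ₑ M′ → M′ ≐ₑ M)

  -- The graph of the function M ↦ f(G,M).
  HasForcingNumber : EdgeSet → Pred ℕ 0ℓ
  HasForcingNumber M k =
    (∃[ S ] IsForcingSet M S × card S ≡ k) ×
    (∀ S → IsForcingSet M S → k ≤ card S)

data Vertexₚ (n : ℕ) : Set where
  uᶠ vᶠ : Fin n → Vertexₚ n

module _ {n : ℕ} .{{_ : NonZero n}} where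

  u v : ℕ → Vertexₚ n
  u i = uᶠ (i mod n)
  v i = vᶠ (i mod n)

private
  swapʳ : ∀ a b c → a + b + c ≡ a + c + b
  swapʳ = solve-∀

  shift-% : ∀ i {d} n .{{_ : NonZero n}} → 0 < d → d < n → i % n ≢ (i + d) % n
  shift-% i {d} n 0<d d<n eq with i % n + d <? n
    | trans (cong (λ j → (j + d) % n) (m≡m%n+[m/n]*n i n))
        (trans (cong (_% n) (swapʳ (i % n) (i / n * n) d)) ([m+kn]%n≡m%n (i % n + d) (i / n) n))
  ... | yes r+d<n | reduce =
    <⇒≢ (m<m+n (i % n) 0<d) (trans eq (trans reduce (m<n⇒m%n≡m r+d<n)))
  ... | no r+d≮n | reduce = <⇒≢ smaller (sym (trans eq (trans reduce wrap)))
    where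
    n≤r+d : n ≤ i % n + d
    n≤r+d = ≮⇒≥ r+d≮n
    smaller : i % n + d ∸ n < i % n
    smaller = +-cancelʳ-< n _ _
      (subst (_< i % n + n) (sym (m∸n+n≡m n≤r+d)) (+-monoʳ-< (i % n) d<n))
    wrap : (i % n + d) % n ≡ i % n + d ∸ n
    wrap = trans (sym (m≤n⇒[n∸m]%m≡n%m n≤r+d))
      (m<n⇒m%n≡m (<-trans smaller (m%n<n i n)))

  shift-mod : ∀ i {d} n .{{_ : NonZero n}} → 0 < d → d < n → i mod n ≢ (i + d) mod n
  shift-mod i {d} n 0<d d<n eq = shift-% i n 0<d d<n
    (trans (sym (toℕ-fromℕ< (m%n<n i n)))
      (trans (cong toℕ eq) (toℕ-fromℕ< (m%n<n (i + d) n))))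

  uᶠ-injective : ∀ {n} {i j : Fin n} → uᶠ i ≡ uᶠ j → i ≡ j
  uᶠ-injective refl = refl

  vᶠ-injective : ∀ {n} {i j : Fin n} → vᶠ i ≡ vᶠ j → i ≡ j
  vᶠ-injective refl = refl

module Petersen (n : ℕ) (n≥3 : 3 ≤ n) where

  instance
    n≢0 : NonZero n
    n≢0 = >-nonZero (≤-trans (s≤s z≤n) n≥3)

  edgeList : List (Vertexₚ n × Vertexₚ n)
  edgeList = concatMap
    (λ i → (u i , u (i + 2)) ∷ (u i , v i) ∷ (v i , v (i + 1)) ∷ []) (upTo n)

  private
    loopless : All (λ e → proj₁ e ≢ proj₂ e) edgeList
    loopless = All.concat⁺ (All.map⁺ (All.universal (λ i →
      (λ eq → shift-mod i n (s≤s z≤n) n≥3 (uᶠ-injective eq))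
      ∷ (λ ())
      ∷ (λ eq → shift-mod i n (s≤s z≤n) (≤-trans (s≤s (s≤s z≤n)) n≥3) (vᶠ-injective eq))
      ∷ []) (upTo n)))

    disjoint : ∀ {x} → ¬ (x ∈ map uᶠ (allFin n) × x ∈ map vᶠ (allFin n))
    disjoint (p , q) with ∈-map⁻ uᶠ p | ∈-map⁻ vᶠ q
    ... | _ , _ , refl | _ , _ , ()

  P : FiniteSimpleGraph
  P = record
    { Vertex   = Vertexₚ n
    ; _~_      = edgesOf edgeList
    ; ~-sym    = swap
    ; ~-irrefl = λ { refl (inj₁ e) → All.lookup loopless e refl
                   ; refl (inj₂ e) → All.lookup loopless e refl }
    ; vertices = map uᶠ (allFin n) ++ map vᶠ (allFin n)
    ; complete = λ { (uᶠ i) → ∈-++⁺ˡ (∈-map⁺ uᶠ (∈-allFin i))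
                   ; (vᶠ i) → ∈-++⁺ʳ (map uᶠ (allFin n)) (∈-map⁺ vᶠ (∈-allFin i)) }
    ; unique   = ++⁺ (map⁺ uᶠ-injective (allFin⁺ n)) (map⁺ vᶠ-injective (allFin⁺ n)) disjoint
    }

  open Forcing P public

  HasSpoke : EdgeSet → ℕ → Set
  HasSpoke M i = u i – v i ∈ₑ M

  -- Spokes i < j ≤ i + n of M with no spoke of M strictly in between;
  -- j = i + n happens exactly when M has a single spoke.
  ConsecutiveSpokes : EdgeSet → ℕ → ℕ → Set
  ConsecutiveSpokes M i j =
    i < j × j ≤ i + n × HasSpoke M i × HasSpoke M j ×
    (∀ k → i < k → k < j → ¬ HasSpoke M k)

  SpokedType : Pred EdgeSet 0ℓ
  SpokedType M =
    (∃[ i ] HasSpoke M i) ×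
    (∀ i j → ConsecutiveSpokes M i j → 4 ∣ (j ∸ i ∸ 1))

  spokelessMatching : ℕ → List (Vertexₚ n × Vertexₚ n)
  spokelessMatching i = concatMap
    (λ k → (u (i + 4 * k)     , u (i + 4 * k + 2))
         ∷ (u (i + 4 * k + 1) , u (i + 4 * k + 3))
         ∷ (v (i + 4 * k)     , v (i + 4 * k + 1))
         ∷ (v (i + 4 * k + 2) , v (i + 4 * k + 3))
         ∷ [])
    (upTo (n / 4))

  SpokelessType : Pred EdgeSet 0ℓ
  SpokelessType M =
    (∀ i → ¬ HasSpoke M i) × 4 ∣ n × (∃[ i ] M ≐[ spokelessMatching i ])

  -- For n ≡ 4, one of the two spokeless matchings satisfying
  -- SpokelessType is deliberately excluded.
  M₁ : Pred EdgeSet 0ℓ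
  M₁ M = IsPerfectMatching M ×
    (  n ≢ 4 × (SpokedType M ⊎ SpokelessType M)
     ⊎ n ≡ 4 × (  M ≐[ map (λ i → u i , v i) (upTo 4) ]
                ⊎ M ≐[ (u 0 , u 2) ∷ (u 1 , u 3) ∷ (v 0 , v 1) ∷ (v 2 , v 3) ∷ [] ]))

  ForcingSpectrum₁ : Pred ℕ 0ℓ
  ForcingSpectrum₁ k = ∃[ M ] M₁ M × HasForcingNumber M k

-- An integer strictly between two naturals is a natural, so for sets of
-- naturals it suffices to let t range over ℕ.
Continuous : Pred ℕ 0ℓ → Set
Continuous A = ∀ {a b} t → A a → A b → a < t → t < b → A t

{-# OPTIONS --safe #-}

-- For n ≠ 4 a matching in ℳ₁(P(n)) is a cyclic tiling by spokes S and blocks B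
-- of four columns: the cut next to a spoke is crossed by no matching edge (the
-- gap condition), and an uncrossed cut determines the next tile. Replacing
-- B by SSSS changes the matching along an alternating 8-cycle. Consider such a
-- replacement together with the tile t to its right, where j is the number of
-- alternating 8-cycles B or SSSS in the window (1 if t = S, 2 if t = B). Every
-- forcing set meets these disjoint cycles, so has at least j edges in the window,
-- and conversely some j + 1 edges force the whole window whatever happens
-- outside. So each replacement changes the forcing number by at most one, and
-- replacements lead from every tiling to the all-spokes matching.
module Submission where

open import Defs
open import Data.Bool.Base using (Bool; true; false; T; not; _∧_; _∨_)
open import Data.Bool.Properties using (T?; T-∧)
import Data.Bool.Properties as Bool
open import Data.Fin.Base using (Fin; toℕ)
open import Data.Fin.Properties using (toℕ-fromℕ<; toℕ-injective; toℕ<n; any?)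
import Data.Fin.Properties as Fin
open import Data.List.Base
  using (List; []; _∷_; _++_; map; length; concatMap; filterᵇ; replicate; upTo)
open import Data.List.Membership.DecPropositional using (_∈?_)
open import Data.List.Membership.Propositional using (_∈_; find; lose)
open import Data.List.Membership.Propositional.Properties
  using (∈-map⁺; ∈-map⁻; ∈-++⁺ˡ; ∈-++⁺ʳ; ∈-++⁻; ∈-∃++; ∈-concatMap⁺; ∈-concatMap⁻; ∈-upTo⁺; ∈-filter⁺; ∈-filter⁻)
open import Data.List.Properties
  using (++-assoc; ++-identityʳ; ++-cancelˡ; length-++; length-map; map-++; concatMap-++; ≡-dec; ∷-injective)
open import Data.List.Relation.Binary.Pointwise as Pointwise using (Pointwise; []; _∷_)
open import Data.List.Relation.Unary.All as All using (All; []; _∷_)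
import Data.List.Relation.Unary.All.Properties as All
open import Data.List.Relation.Unary.AllPairs as AllPairs using (AllPairs; []; _∷_)
import Data.List.Relation.Unary.AllPairs.Properties as AllPairs
open import Data.List.Relation.Unary.Any as Any using (Any; here; there)
open import Data.List.Relation.Unary.Unique.Propositional using (Unique)
open import Data.Nat.Base
open import Data.Nat.DivMod
open import Data.Nat.Divisibility
open import Data.Nat.ListAction using (sum)
open import Data.Nat.ListAction.Properties using (sum-++)
open import Data.Nat.Properties
open import Data.Product using (_×_; _,_; proj₁; proj₂; ∃; ∃-syntax; ∃!; swap; uncurry)
open import Data.Product.Properties using () renaming (≡-dec to ×-≡-dec)
import Data.Sum.Base as ⊎
open import Data.Sum.Base using (_⊎_; inj₁; inj₂)
open import Function.Base using (_∘_; id; case_of_)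
open import Function.Bundles using (Equivalence)
open import Relation.Binary.PropositionalEquality
open import Relation.Nullary using (¬_; Dec; yes; no; contradiction)
open import Relation.Nullary.Decidable
  using (map′; _×-dec_; _→-dec_; _⊎-dec_; ¬?; from-yes; ⌊_⌋; toWitness; fromWitness)

-- The window contains the neighbour `t` because no two edges of B force its four columns by
-- themselves: for each pair, some path through these columns contains the pair and crosses one of
-- the outer cuts. If `t` is itself a block, the anchor needs a third edge, but its 8-cycle also
-- raises the lower bound, so the loss stays one. Forcing whatever happens outside includes that
-- both end cuts of the window are empty; hence in any matching containing the anchor the old window
-- can be pasted back, and the old forcing set then determines the rest. The neighbour has to be a
-- tile other than the replaced one, which fails for a single block, n = 4. In that case also uᵢuᵢ₊₂
-- and uᵢ₊₂uᵢ₊₄ are the same edge, so columns no longer name edges uniquely; n = 4 is treated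
-- directly on the graph. Elsewhere a perfect matching is a closed walk in a finite automaton with
-- cuts as states, which turns all facts about four to eight columns into finite checks.

data Kind : Set where
  rung uu vv : Kind

-- Column i of an edge set: its edges among uᵢvᵢ, uᵢuᵢ₊₂, vᵢvᵢ₊₁. A spoke of a
-- matching excludes the other two, which leaves five columns.
data Col : Set where
  spoke both onlyU onlyV none : Col

contains : Kind → Col → Bool
contains rung spoke = true
contains uu   both  = true
contains uu   onlyU = true
contains vv   both  = true
contains vv   onlyV = true
contains _    _     = false

weight : Col → ℕ
weight spoke = 1
weight both  = 2
weight onlyU = 1
weight onlyV = 1
weight none  = 0

size : List Col → ℕ
size cs = sum (map weight cs)

infix 4 _≼_ _⊑_ _≟ᶜ_

_≼_ : Col → Col → Set
c ≼ d = ∀ k → T (contains k c) → T (contains k d)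

_⊑_ : List Col → List Col → Set
_⊑_ = Pointwise _≼_

exactlyOne : Bool → Bool → Bool → Bool
exactlyOne true  q r = not (q ∨ r)
exactlyOne false true  r = not r
exactlyOne false false r = r

-- The edges uᵢ₋₂uᵢ, uᵢ₋₁uᵢ₊₁, vᵢ₋₁vᵢ crossing the cut before column i.
Cut : Set
Cut = Bool × Bool × Bool

empty : Cut
empty = false , false , false

-- The matching condition at uᵢ and at vᵢ. The middle edge of the cut passes over column i and ends
-- only in column i + 1.
fits : Cut → Col → Bool
fits (x , _ , z) c =
  exactlyOne (contains rung c) (contains uu c) x ∧ exactlyOne (contains rung c) (contains vv c) z

next : Cut → Col → Cut
next (_ , y , _) c = y , contains uu c , contains vv c

data Path : Cut → List Col → Cut → Set where
  []  : ∀ {s} → Path s [] s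
  _∷_ : ∀ {s c cs t} → T (fits s c) → Path (next s c) cs t → Path s (c ∷ cs) t

-- Closed paths stand for perfect matchings of the cyclic graph. The cut `s` is quantified because a
-- competing matching may cross the seam differently from `M`.
Forces : List Col → List Col → Set
Forces M S = S ⊑ M × (∀ s N → Path s N s → S ⊑ N → N ≡ M)

HasMin : List Col → ℕ → Set
HasMin M k = (∃[ S ] Forces M S × size S ≡ k) × (∀ S → Forces M S → k ≤ size S)

-- Decidability

_≟ᶜ_ : (c d : Col) → Dec (c ≡ d)
spoke ≟ᶜ spoke = yes refl
spoke ≟ᶜ both  = no λ ()
spoke ≟ᶜ onlyU = no λ ()
spoke ≟ᶜ onlyV = no λ ()
spoke ≟ᶜ none  = no λ ()
both  ≟ᶜ spoke = no λ ()
both  ≟ᶜ both  = yes refl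
both  ≟ᶜ onlyU = no λ ()
both  ≟ᶜ onlyV = no λ ()
both  ≟ᶜ none  = no λ ()
onlyU ≟ᶜ spoke = no λ ()
onlyU ≟ᶜ both  = no λ ()
onlyU ≟ᶜ onlyU = yes refl
onlyU ≟ᶜ onlyV = no λ ()
onlyU ≟ᶜ none  = no λ ()
onlyV ≟ᶜ spoke = no λ ()
onlyV ≟ᶜ both  = no λ ()
onlyV ≟ᶜ onlyU = no λ ()
onlyV ≟ᶜ onlyV = yes refl
onlyV ≟ᶜ none  = no λ ()
none  ≟ᶜ spoke = no λ ()
none  ≟ᶜ both  = no λ ()
none  ≟ᶜ onlyU = no λ ()
none  ≟ᶜ onlyV = no λ ()
none  ≟ᶜ none  = yes refl

_≟ᶜˢ_ : (M N : List Col) → Dec (M ≡ N)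
_≟ᶜˢ_ = ≡-dec _≟ᶜ_

_≟ˢ_ : (s t : Cut) → Dec (s ≡ t)
_≟ˢ_ = ×-≡-dec Bool._≟_ (×-≡-dec Bool._≟_ Bool._≟_)

allCols? : {P : Col → Set} → (∀ c → Dec (P c)) → Dec (∀ c → P c)
allCols? P? = map′
  (λ { (p , q , r , s , t) → λ { spoke → p ; both → q ; onlyU → r ; onlyV → s ; none → t } })
  (λ f → f spoke , f both , f onlyU , f onlyV , f none)
  (P? spoke ×-dec P? both ×-dec P? onlyU ×-dec P? onlyV ×-dec P? none)

anyCol? : {P : Col → Set} → (∀ c → Dec (P c)) → Dec (∃ P)
anyCol? P? = map′
  (λ { (inj₁ p) → spoke , p
     ; (inj₂ (inj₁ p)) → both , p
     ; (inj₂ (inj₂ (inj₁ p))) → onlyU , p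
     ; (inj₂ (inj₂ (inj₂ (inj₁ p)))) → onlyV , p
     ; (inj₂ (inj₂ (inj₂ (inj₂ p)))) → none , p })
  (λ { (spoke , p) → inj₁ p
     ; (both  , p) → inj₂ (inj₁ p)
     ; (onlyU , p) → inj₂ (inj₂ (inj₁ p))
     ; (onlyV , p) → inj₂ (inj₂ (inj₂ (inj₁ p)))
     ; (none  , p) → inj₂ (inj₂ (inj₂ (inj₂ p))) })
  (P? spoke ⊎-dec P? both ⊎-dec P? onlyU ⊎-dec P? onlyV ⊎-dec P? none)

allKinds? : {P : Kind → Set} → (∀ k → Dec (P k)) → Dec (∀ k → P k)
allKinds? P? = map′
  (λ { (p , q , r) → λ { rung → p ; uu → q ; vv → r } })
  (λ f → f rung , f uu , f vv)
  (P? rung ×-dec P? uu ×-dec P? vv)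

allCuts? : {P : Cut → Set} → (∀ s → Dec (P s)) → Dec (∀ s → P s)
allCuts? P? = map′
  (λ f (x , y , z) → f x y z) (λ f x y z → f (x , y , z))
  (allBools? λ x → allBools? λ y → allBools? λ z → P? (x , y , z))
  where
  allBools? : {Q : Bool → Set} → (∀ x → Dec (Q x)) → Dec (∀ x → Q x)
  allBools? Q? = map′ (λ { (p , q) → λ { true → p ; false → q } }) (λ f → f true , f false)
    (Q? true ×-dec Q? false)

_≼?_ : ∀ c d → Dec (c ≼ d)
c ≼? d = allKinds? λ k → T? _ →-dec T? _

-- The search is finite since `S` fixes the length of `N`; only columns that fit and contain those
-- of `S` are followed.
allPaths? : ∀ {P : List Col → Cut → Set} S s → (∀ N t → Dec (P N t)) →
  Dec (∀ N t → Path s N t → S ⊑ N → P N t)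
allPaths? [] s P? = map′ (λ { p [] _ [] [] → p }) (λ f → f [] s [] []) (P? [] s)
allPaths? (c ∷ S) s P? = map′
  (λ { f (d ∷ N) t (fit ∷ p) (c≼d ∷ S⊑N) → f d fit c≼d N t p S⊑N })
  (λ f d fit c≼d N t p S⊑N → f (d ∷ N) t (fit ∷ p) (c≼d ∷ S⊑N))
  (allCols? λ d → T? (fits s d) →-dec (c ≼? d →-dec
    allPaths? S (next s d) λ N t → P? (d ∷ N) t))

anySub? : ∀ {P : List Col → Set} M → (∀ S → Dec (P S)) → Dec (∃[ S ] S ⊑ M × P S)
anySub? [] P? = map′ (λ p → [] , [] , p) (λ { (_ , [] , p) → p }) (P? [])
anySub? (d ∷ M) P? = map′
  (λ { (c , c≼d , S , S⊑M , p) → c ∷ S , c≼d ∷ S⊑M , p })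
  (λ { (_ , c≼d ∷ S⊑M , p) → _ , c≼d , _ , S⊑M , p })
  (anyCol? λ c → c ≼? d ×-dec anySub? M λ S → P? (c ∷ S))

forces? : ∀ M S → S ⊑ M → Dec (Forces M S)
forces? M S S⊑M = map′
  (λ f → S⊑M , λ s N p q → f s N s p q refl)
  (λ { (_ , f) s N t p q refl → f s N p q })
  (allCuts? λ s → allPaths? S s λ N t → (t ≟ˢ s) →-dec (N ≟ᶜˢ M))

forcesOfSize? : ∀ M k → Dec (∃[ S ] Forces M S × size S ≡ k)
forcesOfSize? M k = map′
  (λ { (S , S⊑M , F , e) → S , F S⊑M , e })
  (λ { (S , F , e) → S , proj₁ F , (λ _ → F) , e })
  (anySub? M λ S → forces′? S ×-dec (size S ≟ k))
  where
  ⊑? : ∀ S N → Dec (S ⊑ N)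
  ⊑? = Pointwise.decidable _≼?_
  forces′? : ∀ S → Dec (S ⊑ M → Forces M S)
  forces′? S with ⊑? S M
  ... | yes p = map′ (λ F _ → F) (λ F → F p) (forces? M S p)
  ... | no ¬p = yes λ p → contradiction p ¬p

least : ∀ {P : ℕ → Set} → (∀ k → Dec (P k)) → ∀ k → P k →
  ∃[ m ] P m × (∀ j → P j → m ≤ j)
least P? k pk with P? 0
... | yes p0 = 0 , p0 , λ _ _ → z≤n
least P? zero pk | no ¬p0 = contradiction pk ¬p0
least {P} P? (suc k) pk | no ¬p0 =
  let m , pm , low = least {P ∘ suc} (P? ∘ suc) k pk
  in suc m , pm , λ { zero p0 → contradiction p0 ¬p0 ; (suc j) pj → s≤s (low j pj) }

-- Decidability of forcing for each size gives the minimum constructively, as soon as one forcing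
-- set is known.
hasMin : ∀ {M S} → Forces M S → ∃[ k ] HasMin M k
hasMin {M} {S} F =
  let k , attained , low = least (forcesOfSize? M) (size S) (S , F , refl)
  in k , attained , λ S′ F′ → low (size S′) (S′ , F′ , refl)

hasMin-unique : ∀ {M j k} → HasMin M j → HasMin M k → j ≡ k
hasMin-unique ((S , F , refl) , low) ((S′ , F′ , refl) , low′) =
  ≤-antisym (low S′ F′) (low′ S F)

-- Concatenation and rotation

_++ᵖ_ : ∀ {s t r M N} → Path s M t → Path t N r → Path s (M ++ N) r
[]      ++ᵖ q = q
(f ∷ p) ++ᵖ q = f ∷ (p ++ᵖ q)

split-path : ∀ M {N s r} → Path s (M ++ N) r → ∃[ t ] Path s M t × Path t N r
split-path []      p = _ , [] , p
split-path (_ ∷ M) (f ∷ p) = let t , q , r = split-path M p in t , f ∷ q , r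

split-⊑ : ∀ M {N S} → S ⊑ M ++ N → ∃[ S₁ ] ∃[ S₂ ] S ≡ S₁ ++ S₂ × S₁ ⊑ M × S₂ ⊑ N
split-⊑ []      p = [] , _ , refl , [] , p
split-⊑ (_ ∷ M) (c ∷ p) = let S₁ , S₂ , e , q , r = split-⊑ M p in
  _ ∷ S₁ , S₂ , cong (_ ∷_) e , c ∷ q , r

⊑-split : ∀ S {T N} → S ++ T ⊑ N → ∃[ N₁ ] ∃[ N₂ ] N ≡ N₁ ++ N₂ × S ⊑ N₁ × T ⊑ N₂
⊑-split []      p = [] , _ , refl , [] , p
⊑-split (_ ∷ S) (c ∷ p) = let N₁ , N₂ , e , q , r = ⊑-split S p in
  _ ∷ N₁ , N₂ , cong (_ ∷_) e , c ∷ q , r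

⊑-refl : ∀ {M} → M ⊑ M
⊑-refl = Pointwise.refl λ _ → id

size-++ : ∀ S T → size (S ++ T) ≡ size S + size T
size-++ S T = trans (cong sum (map-++ weight S T)) (sum-++ (map weight S) (map weight T))

⊑-length : ∀ {S N M} → S ⊑ M → S ⊑ N → length N ≡ length M
⊑-length p q = trans (sym (Pointwise.Pointwise-length q)) (Pointwise.Pointwise-length p)

++-injective : ∀ {A : Set} (xs xs′ : List A) {ys ys′} → length xs ≡ length xs′ →
  xs ++ ys ≡ xs′ ++ ys′ → xs ≡ xs′ × ys ≡ ys′
++-injective []       []         _ e    = refl , e
++-injective (x ∷ xs) (x′ ∷ xs′) l e with refl , e′ ← ∷-injective e =
  let p , q = ++-injective xs xs′ (suc-injective l) e′ in cong (x ∷_) p , q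

-- A closed path may be opened at any of its cuts: the cut between the two pieces becomes the new
-- seam.
rotate-forces : ∀ M N {S} → Forces (M ++ N) S → ∃[ S′ ] Forces (N ++ M) S′ × size S′ ≡ size S
rotate-forces M N (S⊑ , F) with S₁ , S₂ , refl , p , q ← split-⊑ M S⊑ =
  S₂ ++ S₁ , (Pointwise.++⁺ q p , G) ,
  trans (size-++ S₂ S₁) (trans (+-comm (size S₂) (size S₁)) (sym (size-++ S₁ S₂)))
  where
  G : ∀ s L → Path s L s → S₂ ++ S₁ ⊑ L → L ≡ N ++ M
  G s L path S⊑L with N′ , M′ , refl , q′ , p′ ← ⊑-split S₂ S⊑L
    with t , path₁ , path₂ ← split-path N′ path =
    let e₁ , e₂ = ++-injective M′ M (⊑-length p p′)
                    (F t (M′ ++ N′) (path₂ ++ᵖ path₁) (Pointwise.++⁺ p′ q′))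
    in cong₂ _++_ e₂ e₁

rotate-hasMin : ∀ M N {k} → HasMin (M ++ N) k → HasMin (N ++ M) k
rotate-hasMin M N ((S , F , e) , low) =
  (let S′ , F′ , e′ = rotate-forces M N F in S′ , F′ , trans e′ e) ,
  λ S′ F′ → let S″ , F″ , e″ = rotate-forces N M F′ in ≤-trans (low S″ F″) (≤-reflexive e″)

-- Tilings

data Tile : Set where
  S B : Tile

columns : Tile → List Col
columns S = spoke ∷ []
columns B = both ∷ onlyU ∷ onlyV ∷ none ∷ []

⟦_⟧ : List Tile → List Col
⟦_⟧ = concatMap columns

⟦⟧-++ : ∀ w w′ → ⟦ w ++ w′ ⟧ ≡ ⟦ w ⟧ ++ ⟦ w′ ⟧
⟦⟧-++ = concatMap-++ columns

tiling-path : ∀ w → Path empty ⟦ w ⟧ empty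
tiling-path []      = []
tiling-path (S ∷ w) = _ ∷ tiling-path w
tiling-path (B ∷ w) = _ ∷ _ ∷ _ ∷ _ ∷ tiling-path w

-- B and SSSS complement each other in an alternating 8-cycle.
data Quad : Set where
  block spokes : Quad

flip : Quad → Quad
flip block  = spokes
flip spokes = block

tiles : Quad → List Tile
tiles block  = B ∷ []
tiles spokes = S ∷ S ∷ S ∷ S ∷ []

weightless-⊑ : ∀ {M N T} → length M ≡ length N → size T ≡ 0 → T ⊑ M → T ⊑ N
weightless-⊑ {[]}    {[]}    _ _ []      = []
weightless-⊑ {_ ∷ _} {_ ∷ _} {none ∷ _} l z (_ ∷ p) =
  (λ { rung () ; uu () ; vv () }) ∷ weightless-⊑ (suc-injective l) z p

-- A forcing set without an edge in the quad would also be contained in the tiling with the quad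
-- flipped, which is a different matching.
quad-meets : ∀ x q y {T₁ T₂ T₃} → T₁ ⊑ ⟦ x ⟧ → T₂ ⊑ ⟦ tiles q ⟧ → T₃ ⊑ ⟦ y ⟧ →
  Forces (⟦ x ⟧ ++ ⟦ tiles q ⟧ ++ ⟦ y ⟧) (T₁ ++ T₂ ++ T₃) → 1 ≤ size T₂
quad-meets x q y {T₂ = T₂} p₁ p₂ p₃ (_ , F) = n≢0⇒n>0 λ z →
  distinct q (proj₁ (++-injective _ _ (sym (same-length q)) (++-cancelˡ ⟦ x ⟧ _ _
    (F empty _ (tiling-path x ++ᵖ (tiling-path (tiles (flip q)) ++ᵖ tiling-path y))
      (Pointwise.++⁺ p₁ (Pointwise.++⁺ (weightless-⊑ (same-length q) z p₂) p₃))))))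
  where
  same-length : ∀ q → length ⟦ tiles q ⟧ ≡ length ⟦ tiles (flip q) ⟧
  same-length block  = refl
  same-length spokes = refl
  distinct : ∀ q → ⟦ tiles (flip q) ⟧ ≢ ⟦ tiles q ⟧
  distinct block  ()
  distinct spokes ()

-- Edges that force a quad and its right neighbour whatever happens outside
-- these columns.
anchor : Quad → Tile → List Col
anchor block  S = none ∷ onlyU ∷ none ∷ none ∷ spoke ∷ []
anchor spokes S = spoke ∷ none ∷ none ∷ none ∷ spoke ∷ []
anchor block  B = onlyU ∷ onlyU ∷ none ∷ none ∷ onlyV ∷ none ∷ none ∷ none ∷ []
anchor spokes B = spoke ∷ none ∷ spoke ∷ none ∷ onlyV ∷ none ∷ none ∷ none ∷ []

window : Quad → Tile → List Col
window q t = ⟦ tiles q ⟧ ++ columns t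

abstract
  anchor-⊑ : ∀ q t → anchor q t ⊑ window q t
  anchor-⊑ block  S = from-yes (Pointwise.decidable _≼?_ (anchor block S) (window block S))
  anchor-⊑ spokes S = from-yes (Pointwise.decidable _≼?_ (anchor spokes S) (window spokes S))
  anchor-⊑ block  B = from-yes (Pointwise.decidable _≼?_ (anchor block B) (window block B))
  anchor-⊑ spokes B = from-yes (Pointwise.decidable _≼?_ (anchor spokes B) (window spokes B))

-- Stronger than `Forces`: the path need not be closed, and its end cuts come out empty, which
-- allows cutting and pasting there.
Rigid : List Col → List Col → Set
Rigid M T = ∀ s N t → Path s N t → T ⊑ N → N ≡ M × s ≡ empty × t ≡ empty

rigid? : ∀ M T → Dec (Rigid M T)
rigid? M T = allCuts? λ s → allPaths? T s λ N t → (N ≟ᶜˢ M) ×-dec (s ≟ˢ empty) ×-dec (t ≟ˢ empty)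

abstract
  anchor-rigid : ∀ q t → Rigid (window q t) (anchor q t)
  anchor-rigid block  S = from-yes (rigid? (window block S) (anchor block S))
  anchor-rigid spokes S = from-yes (rigid? (window spokes S) (anchor spokes S))
  anchor-rigid block  B = from-yes (rigid? (window block B) (anchor block B))
  anchor-rigid spokes B = from-yes (rigid? (window spokes B) (anchor spokes B))

-- Here `j` counts the disjoint alternating 8-cycles of the old window, each costing the old forcing
-- set an edge: the quad itself and, for `t = B`, the neighbour as a second quad.
anchor-cost : ∀ q t → ∃[ j ] size (anchor (flip q) t) ≡ suc j ×
  (∀ r {T₁ T₂} → T₁ ⊑ window q t → T₂ ⊑ ⟦ r ⟧ → Forces (window q t ++ ⟦ r ⟧) (T₁ ++ T₂) → j ≤ size T₁)
anchor-cost q S = 1 , size-anchor q , bound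
  where
  size-anchor : ∀ q → size (anchor (flip q) S) ≡ 2
  size-anchor block  = refl
  size-anchor spokes = refl
  bound : ∀ r {T₁ T₂} → T₁ ⊑ window q S → T₂ ⊑ ⟦ r ⟧ →
    Forces (window q S ++ ⟦ r ⟧) (T₁ ++ T₂) → 1 ≤ size T₁
  bound r p₁ p₂ F with X , Y , refl , x , y ← split-⊑ ⟦ tiles q ⟧ p₁ =
    ≤-trans (quad-meets [] q (S ∷ r) [] x (Pointwise.++⁺ y p₂)
               (subst₂ Forces (++-assoc ⟦ tiles q ⟧ _ _) (++-assoc X _ _) F))
            (≤-trans (m≤m+n _ _) (≤-reflexive (sym (size-++ X Y))))
anchor-cost q B = 2 , size-anchor q , bound
  where
  size-anchor : ∀ q → size (anchor (flip q) B) ≡ 3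
  size-anchor block  = refl
  size-anchor spokes = refl
  bound : ∀ r {T₁ T₂} → T₁ ⊑ window q B → T₂ ⊑ ⟦ r ⟧ →
    Forces (window q B ++ ⟦ r ⟧) (T₁ ++ T₂) → 2 ≤ size T₁
  bound r p₁ p₂ F with X , Y , refl , x , y ← split-⊑ ⟦ tiles q ⟧ p₁ =
    ≤-trans (+-mono-≤ (quad-meets [] q (B ∷ r) [] x (Pointwise.++⁺ y p₂) F′)
                      (quad-meets (tiles q) block r x y p₂ F′))
            (≤-reflexive (sym (size-++ X Y)))
    where F′ = subst₂ Forces (++-assoc ⟦ tiles q ⟧ _ _) (++-assoc X _ _) F

-- The new forcing set is the anchor inside the window and the old set outside it.
flip-forces : ∀ q t r {T} → Forces (window q t ++ ⟦ r ⟧) T →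
  ∃[ T′ ] Forces (window (flip q) t ++ ⟦ r ⟧) T′ × size T′ ≤ suc (size T)
flip-forces q t r (T⊑ , F) with T₁ , T₂ , refl , p₁ , p₂ ← split-⊑ (window q t) T⊑ =
  T₁′ ++ T₂ , (Pointwise.++⁺ (anchor-⊑ (flip q) t) p₂ , G) , cost
  where
  T₁′ = anchor (flip q) t
  window-path : Path empty (window q t) empty
  window-path = tiling-path (tiles q) ++ᵖ subst (λ cs → Path empty cs empty) (++-identityʳ _) (tiling-path (t ∷ []))
  G : ∀ s N → Path s N s → T₁′ ++ T₂ ⊑ N → N ≡ window (flip q) t ++ ⟦ r ⟧
  G s N path ⊑N with N₁ , N₂ , refl , n₁ , n₂ ← ⊑-split T₁′ ⊑N
    with s′ , path₁ , path₂ ← split-path N₁ path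
    with refl , refl , refl ← anchor-rigid (flip q) t s N₁ s′ path₁ n₁ =
    -- Both cuts are now empty, so the old window followed by `N₂` is a closed path containing the
    -- old forcing set; this determines `N₂`.
    cong (window (flip q) t ++_)
      (++-cancelˡ (window q t) _ _ (F empty _ (window-path ++ᵖ path₂) (Pointwise.++⁺ p₁ n₂)))
  cost : size (T₁′ ++ T₂) ≤ suc (size (T₁ ++ T₂))
  cost with j , e , bound ← anchor-cost q t = begin
    size (T₁′ ++ T₂)          ≡⟨ size-++ T₁′ T₂ ⟩
    size T₁′ + size T₂        ≡⟨ cong (_+ size T₂) e ⟩
    suc (j + size T₂)         ≤⟨ s≤s (+-monoˡ-≤ (size T₂) (bound r p₁ p₂ (T⊑ , F))) ⟩
    suc (size T₁ + size T₂)   ≡⟨ cong suc (size-++ T₁ T₂) ⟨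
    suc (size (T₁ ++ T₂))     ∎
    where open ≤-Reasoning

window-tiling : ∀ q t r → ⟦ tiles q ++ t ∷ r ⟧ ≡ window q t ++ ⟦ r ⟧
window-tiling q t r = trans (⟦⟧-++ (tiles q) (t ∷ r)) (sym (++-assoc ⟦ tiles q ⟧ (columns t) ⟦ r ⟧))

flip-tiling-forces : ∀ q t r {T} → Forces ⟦ tiles q ++ t ∷ r ⟧ T →
  ∃[ T′ ] Forces ⟦ tiles (flip q) ++ t ∷ r ⟧ T′ × size T′ ≤ suc (size T)
flip-tiling-forces q t r F =
  let T′ , F′ , le = flip-forces q t r (subst (λ M → Forces M _) (window-tiling q t r) F)
  in T′ , subst (λ M → Forces M T′) (sym (window-tiling (flip q) t r)) F′ , le

-- Transferring a minimum forcing set each way bounds each minimum by the other plus one; the first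
-- transfer also shows that `M′` has a forcing set at all.
adjacent-minima : ∀ {M M′} →
  (∀ {T} → Forces M T → ∃[ T′ ] Forces M′ T′ × size T′ ≤ suc (size T)) →
  (∀ {T} → Forces M′ T → ∃[ T′ ] Forces M T′ × size T′ ≤ suc (size T)) →
  ∀ {k} → HasMin M k → ∃[ k′ ] HasMin M′ k′ × k′ ≤ suc k × k ≤ suc k′
adjacent-minima to from ((T , F , refl) , low) =
  let T′ , F′ , le = to F
      k′ , attained , low′ = hasMin F′
      U , G , e = attained
      U′ , G′ , le′ = from G
  in k′ , (attained , low′) , ≤-trans (low′ T′ F′) le ,
     ≤-trans (low U′ G′) (≤-trans le′ (s≤s (≤-reflexive e)))

flip-hasMin : ∀ t r {k} → HasMin ⟦ B ∷ t ∷ r ⟧ k →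
  ∃[ k′ ] HasMin ⟦ S ∷ S ∷ S ∷ S ∷ t ∷ r ⟧ k′ × k′ ≤ suc k × k ≤ suc k′
flip-hasMin t r = adjacent-minima (flip-tiling-forces block t r) (flip-tiling-forces spokes t r)

blocks : List Tile → ℕ
blocks []      = 0
blocks (S ∷ w) = blocks w
blocks (B ∷ w) = suc (blocks w)

blocks-++ : ∀ w w′ → blocks (w ++ w′) ≡ blocks w + blocks w′
blocks-++ []      w′ = refl
blocks-++ (S ∷ w) w′ = blocks-++ w w′
blocks-++ (B ∷ w) w′ = cong suc (blocks-++ w w′)

no-blocks : ∀ w → blocks w ≡ 0 → ⟦ w ⟧ ≡ replicate (length ⟦ w ⟧) spoke
no-blocks []      _ = refl
no-blocks (S ∷ w) e = cong (spoke ∷_) (no-blocks w e)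

find-block : ∀ w {m} → blocks w ≡ suc m → ∃[ x ] ∃[ y ] w ≡ x ++ B ∷ y
find-block (S ∷ w) e = let x , y , e′ = find-block w e in S ∷ x , y , cong (S ∷_) e′
find-block (B ∷ w) e = [] , w , refl

rotate-length : ∀ x y → length ⟦ x ++ y ⟧ ≡ length ⟦ y ++ x ⟧
rotate-length x y = begin
  length ⟦ x ++ y ⟧                ≡⟨ cong length (⟦⟧-++ x y) ⟩
  length (⟦ x ⟧ ++ ⟦ y ⟧)          ≡⟨ length-++ ⟦ x ⟧ ⟩
  length ⟦ x ⟧ + length ⟦ y ⟧      ≡⟨ +-comm (length ⟦ x ⟧) _ ⟩
  length ⟦ y ⟧ + length ⟦ x ⟧      ≡⟨ length-++ ⟦ y ⟧ ⟨
  length (⟦ y ⟧ ++ ⟦ x ⟧)          ≡⟨ cong length (⟦⟧-++ y x) ⟨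
  length ⟦ y ++ x ⟧                ∎
  where open ≡-Reasoning

-- Interpolation between forcing numbers

-- The leading spoke ensures that only matchings with spokes have to be constructed from tilings.
-- Every replacement of a block produces such a tiling.
Realised : ℕ → ℕ → Set
Realised n t = ∃[ w ] length ⟦ S ∷ w ⟧ ≡ n × HasMin ⟦ S ∷ w ⟧ t

-- The start `k` is excluded because its tiling may have no spoke; the end `c` is included so that
-- two ranges ending at `c` leave no gap there.
Between : ℕ → ℕ → ℕ → Set
Between k t c = (k < t × t ≤ c) ⊎ (c ≤ t × t < k)

-- A step of size at most one skips nothing: a value in the range from `k` is `k′` or lies in the
-- range from `k′`.
extend : ∀ {n k k′ c t} → k′ ≤ suc k → k ≤ suc k′ → Realised n k′ →
  (Between k′ t c → Realised n t) → Between k t c → Realised n t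
extend k′≤ k≤ real between (inj₁ (k<t , t≤c)) with m≤n⇒m<n∨m≡n (≤-trans k′≤ k<t)
... | inj₁ k′<t = between (inj₁ (k′<t , t≤c))
... | inj₂ refl = real
extend k′≤ k≤ real between (inj₂ (c≤t , t<k)) with m≤n⇒m<n∨m≡n (s≤s⁻¹ (≤-trans t<k k≤))
... | inj₁ t<k′ = between (inj₂ (c≤t , t<k′))
... | inj₂ refl = real

-- Induction on the number of blocks; a rotation brings one block to the front and the tile
-- cyclically after it into second place.
descent : ∀ {n} → n ≢ 4 → ∀ m w → blocks w ≡ m → length ⟦ w ⟧ ≡ n → ∀ {k} → HasMin ⟦ w ⟧ k →
  ∃[ c ] HasMin (replicate n spoke) c × (∀ t → Between k t c → Realised n t)
descent n≢4 zero w e refl {k} min = k , subst (λ M → HasMin M k) (no-blocks w e) min ,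
  λ { t (inj₁ (k<t , t≤k)) → contradiction k<t (≤⇒≯ t≤k)
    ; t (inj₂ (k≤t , t<k)) → contradiction t<k (≤⇒≯ k≤t) }
descent {n} n≢4 (suc m) w e len {k} min with x , y , refl ← find-block w e = go (y ++ x) refl
  where
  blocks≡ : ∀ z → z ≡ y ++ x → blocks z ≡ m
  blocks≡ z z≡ = suc-injective (begin
    suc (blocks z)                  ≡⟨ cong (suc ∘ blocks) z≡ ⟩
    suc (blocks (y ++ x))           ≡⟨ blocks-++ (B ∷ y) x ⟩
    blocks (B ∷ y) + blocks x       ≡⟨ +-comm (blocks (B ∷ y)) (blocks x) ⟩
    blocks x + blocks (B ∷ y)       ≡⟨ blocks-++ x (B ∷ y) ⟨
    blocks (x ++ B ∷ y)             ≡⟨ e ⟩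
    suc m                           ∎)
    where open ≡-Reasoning
  length≡ : ∀ z → z ≡ y ++ x → length ⟦ B ∷ z ⟧ ≡ n
  length≡ z z≡ = trans (cong (λ z → length ⟦ B ∷ z ⟧) z≡) (trans (sym (rotate-length x (B ∷ y))) len)
  go : ∀ z → z ≡ y ++ x →
    ∃[ c ] HasMin (replicate n spoke) c × (∀ t → Between k t c → Realised n t)
  -- A block without a neighbour is the whole tiling, so the row has four columns.
  go [] z≡ = contradiction (sym (length≡ [] z≡)) n≢4
  go (t₀ ∷ r) z≡ =
    let k′ , min′ , k′≤ , k≤ = flip-hasMin t₀ r
           (subst (λ z → HasMin ⟦ B ∷ z ⟧ k) (sym z≡)
             (subst (λ M → HasMin M k) (sym (⟦⟧-++ (B ∷ y) x))
               (rotate-hasMin ⟦ x ⟧ ⟦ B ∷ y ⟧ (subst (λ M → HasMin M k) (⟦⟧-++ x (B ∷ y)) min))))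
        c , minc , between =
          descent n≢4 m (S ∷ S ∷ S ∷ S ∷ t₀ ∷ r) (blocks≡ (t₀ ∷ r) z≡) (length≡ (t₀ ∷ r) z≡) min′
    in c , minc , λ t t-between → extend k′≤ k≤ (S ∷ S ∷ S ∷ t₀ ∷ r , length≡ (t₀ ∷ r) z≡ , min′) (between t) t-between

-- Both descents end at the forcing number `c` of the all-spokes matching, so `t` is met by the
-- descent from `a` if `t ≤ c` and by the one from `b` otherwise.
interpolate : ∀ {n} → n ≢ 4 → ∀ {w w′} → length ⟦ w ⟧ ≡ n → length ⟦ w′ ⟧ ≡ n →
  ∀ {a b} → HasMin ⟦ w ⟧ a → HasMin ⟦ w′ ⟧ b → ∀ t → a < t → t < b → Realised n t
interpolate n≢4 {w} {w′} len len′ min min′ t a<t t<b =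
  let c , minc , between = descent n≢4 _ w refl len min
      c′ , minc′ , between′ = descent n≢4 _ w′ refl len′ min′
  in case ≤-total t c of λ
    { (inj₁ t≤c) → between t (inj₁ (a<t , t≤c))
    ; (inj₂ c≤t) → between′ t (inj₂ (≤-trans (≤-reflexive (hasMin-unique minc′ minc)) c≤t , t<b)) }

-- Counting

-- The partner `y` of the first entry is removed from `ys`; by exclusion the remaining entries still
-- find their partners.
pigeonhole : ∀ {A B : Set} {R : A → B → Set} {D : A → A → Set} →
  (∀ {x x′ y} → D x x′ → R x y → ¬ R x′ y) → ∀ {xs} ys → AllPairs D xs →
  (∀ {x} → x ∈ xs → ∃[ y ] y ∈ ys × R x y) → length xs ≤ length ys
pigeonhole excl ys [] f = z≤n
pigeonhole {R = R} {D} excl ys (_∷_ {x} {xs} d ds) f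
  with y , y∈ , r ← f (here refl) with ys₁ , ys₂ , refl ← ∈-∃++ y∈ = begin
    suc (length xs)                  ≤⟨ s≤s (pigeonhole excl (ys₁ ++ ys₂) ds g) ⟩
    suc (length (ys₁ ++ ys₂))        ≡⟨ cong suc (length-++ ys₁) ⟩
    suc (length ys₁ + length ys₂)    ≡⟨ +-suc (length ys₁) (length ys₂) ⟨
    length ys₁ + suc (length ys₂)    ≡⟨ length-++ ys₁ ⟨
    length (ys₁ ++ y ∷ ys₂)          ∎
  where
  open ≤-Reasoning
  g : ∀ {x′} → x′ ∈ xs → ∃[ y′ ] y′ ∈ ys₁ ++ ys₂ × R x′ y′
  g x′∈ with f (there x′∈)
  ... | y′ , y′∈ , r′ with ∈-++⁻ ys₁ y′∈
  ...   | inj₁ p         = y′ , ∈-++⁺ˡ p , r′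
  ...   | inj₂ (there p) = y′ , ∈-++⁺ʳ ys₁ p , r′
  ...   | inj₂ (here refl) = contradiction r′ (excl (All.lookup d x′∈) r)

unorderedPairs⁻ : ∀ {A : Set} {x y : A} xs → (x , y) ∈ unorderedPairs xs → x ∈ xs × y ∈ xs
unorderedPairs⁻ (z ∷ zs) p with ∈-++⁻ (map (z ,_) zs) p
... | inj₁ q with _ , y∈ , refl ← ∈-map⁻ (z ,_) q = here refl , there y∈
... | inj₂ q = let x∈ , y∈ = unorderedPairs⁻ zs q in there x∈ , there y∈

unorderedPairs⁺ : ∀ {A : Set} {x y : A} {xs} → x ∈ xs → y ∈ xs → x ≢ y →
  (x , y) ∈ unorderedPairs xs ⊎ (y , x) ∈ unorderedPairs xs
unorderedPairs⁺ (here refl) (here refl) ne = contradiction refl ne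
unorderedPairs⁺ (here refl) (there q) ne = inj₁ (∈-++⁺ˡ (∈-map⁺ _ q))
unorderedPairs⁺ (there p) (here refl) ne = inj₂ (∈-++⁺ˡ (∈-map⁺ _ p))
unorderedPairs⁺ {xs = z ∷ zs} (there p) (there q) ne with unorderedPairs⁺ p q ne
... | inj₁ r = inj₁ (∈-++⁺ʳ (map (z ,_) zs) r)
... | inj₂ r = inj₂ (∈-++⁺ʳ (map (z ,_) zs) r)

Apart : ∀ {A : Set} → A × A → A × A → Set
Apart p q = p ≢ q × p ≢ swap q

unorderedPairs-apart : ∀ {A : Set} {xs : List A} → Unique xs → AllPairs Apart (unorderedPairs xs)
unorderedPairs-apart [] = []
unorderedPairs-apart {xs = x ∷ xs} (x∉ ∷ un) = AllPairs.++⁺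
  (AllPairs.map⁺ (first un (All.tabulate id)))
  (unorderedPairs-apart un)
  (All.map⁺ (All.tabulate λ z∈ → All.tabulate λ p∈ →
    (λ { refl → All.lookup x∉ (proj₁ (unorderedPairs⁻ xs p∈)) refl }) ,
    (λ { refl → All.lookup x∉ (proj₂ (unorderedPairs⁻ xs p∈)) refl })))
  where
  first : ∀ {ys} → Unique ys → All (_∈ xs) ys → AllPairs (λ y z → Apart (x , y) (x , z)) ys
  first [] [] = []
  first (y∉ ∷ un) (y∈ ∷ sub) =
    All.zipWith (λ (y≢z , z∈) →
      (λ { refl → y≢z refl }) , (λ { refl → All.lookup x∉ z∈ refl })) (y∉ , sub)
    ∷ first un sub

-- Column sequences

module _ (Y : ℕ → Col) where

  segment : ℕ → ℕ → List Col
  segment q zero    = []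
  segment q (suc m) = Y q ∷ segment (suc q) m

  -- The cut before column `2 + j`; the offset keeps the two columns it looks back to inside ℕ.
  cut : ℕ → Cut
  cut j = contains uu (Y j) , contains uu (Y (suc j)) , contains vv (Y (suc j))

  Fits : ℕ → Set
  Fits j = T (fits (cut j) (Y (2 + j)))

  segment-length : ∀ q m → length (segment q m) ≡ m
  segment-length q zero    = refl
  segment-length q (suc m) = cong suc (segment-length (suc q) m)

  segment-++ : ∀ q m m′ → segment q (m + m′) ≡ segment q m ++ segment (q + m) m′
  segment-++ q zero    m′ = cong (λ p → segment p m′) (sym (+-identityʳ q))
  segment-++ q (suc m) m′ = cong (Y q ∷_) (trans (segment-++ (suc q) m m′)
    (cong (λ p → segment (suc q) m ++ segment p m′) (sym (+-suc q m))))

  fits⇒path : (∀ j → Fits j) → ∀ j m → Path (cut j) (segment (2 + j) m) (cut (j + m))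
  fits⇒path f j zero    = subst (λ i → Path (cut j) [] (cut i)) (sym (+-identityʳ j)) []
  fits⇒path f j (suc m) = f j ∷
    subst (λ i → Path (cut (suc j)) (segment (3 + j) m) (cut i)) (sym (+-suc j m)) (fits⇒path f (suc j) m)

  -- The initial cut `s` is unrelated to `Y`; only after two columns is the running cut read off
  -- from `Y`.
  path⇒fits : ∀ {s t} q m → Path s (segment q m) t → ∀ j → 2 + j < m → Fits (q + j)
  path⇒fits q (suc (suc (suc m))) (_ ∷ _ ∷ f ∷ _) zero _ = subst Fits (sym (+-identityʳ q)) f
  path⇒fits q 2 _ zero (s≤s (s≤s ()))
  path⇒fits q (suc m) (_ ∷ p) (suc j) (s≤s lt) =
    subst Fits (sym (+-suc q j)) (path⇒fits (suc q) m p j lt)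

segment-cong : ∀ {Y Z} q q′ m → (∀ i → i < m → Y (q + i) ≡ Z (q′ + i)) → segment Y q m ≡ segment Z q′ m
segment-cong q q′ zero f = refl
segment-cong {Y} {Z} q q′ (suc m) f = cong₂ _∷_
  (subst₂ (λ i j → Y i ≡ Z j) (+-identityʳ q) (+-identityʳ q′) (f 0 z<s))
  (segment-cong (suc q) (suc q′) m λ i i<m →
    subst₂ (λ i j → Y i ≡ Z j) (+-suc q i) (+-suc q′ i) (f (suc i) (s<s i<m)))

segment-⊑⁺ : ∀ {Y Z} q m → (∀ i → Y i ≼ Z i) → segment Y q m ⊑ segment Z q m
segment-⊑⁺ q zero    f = []
segment-⊑⁺ q (suc m) f = f q ∷ segment-⊑⁺ (suc q) m f

segment-⊑⁻ : ∀ {Y Z} q m → segment Y q m ⊑ segment Z q m → ∀ i → i < m → Y (q + i) ≼ Z (q + i)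
segment-⊑⁻ {Y} {Z} q (suc m) (c ∷ p) zero _ = subst (λ j → Y j ≼ Z j) (sym (+-identityʳ q)) c
segment-⊑⁻ {Y} {Z} q (suc m) (c ∷ p) (suc i) (s≤s i<m) =
  subst (λ j → Y j ≼ Z j) (sym (+-suc q i)) (segment-⊑⁻ (suc q) m p i i<m)

nth : List Col → ℕ → Col
nth []       _       = none
nth (c ∷ cs) zero    = c
nth (c ∷ cs) (suc i) = nth cs i

segment-nth : ∀ cs → segment (nth cs) 0 (length cs) ≡ cs
segment-nth []       = refl
segment-nth (c ∷ cs) = cong (c ∷_) (trans (segment-cong 1 0 (length cs) λ _ _ → refl) (segment-nth cs))

kindsOf : Col → List Kind
kindsOf spoke = rung ∷ []
kindsOf both  = uu ∷ vv ∷ []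
kindsOf onlyU = uu ∷ []
kindsOf onlyV = vv ∷ []
kindsOf none  = []

length-kindsOf : ∀ c → length (kindsOf c) ≡ weight c
length-kindsOf spoke = refl
length-kindsOf both  = refl
length-kindsOf onlyU = refl
length-kindsOf onlyV = refl
length-kindsOf none  = refl

kindsOf-unique : ∀ c → Unique (kindsOf c)
kindsOf-unique spoke = [] ∷ []
kindsOf-unique both  = ((λ ()) ∷ []) ∷ [] ∷ []
kindsOf-unique onlyU = [] ∷ []
kindsOf-unique onlyV = [] ∷ []
kindsOf-unique none  = []

∈-kindsOf : ∀ k c → T (contains k c) → k ∈ kindsOf c
∈-kindsOf rung spoke _ = here refl
∈-kindsOf uu   both  _ = here refl
∈-kindsOf vv   both  _ = there (here refl)
∈-kindsOf uu   onlyU _ = here refl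
∈-kindsOf vv   onlyV _ = here refl

kindsOf⁻ : ∀ k c → k ∈ kindsOf c → T (contains k c)
kindsOf⁻ _ spoke (here refl) = _
kindsOf⁻ _ both  (here refl) = _
kindsOf⁻ _ both  (there (here refl)) = _
kindsOf⁻ _ onlyU (here refl) = _
kindsOf⁻ _ onlyV (here refl) = _

module _ (Y : ℕ → Col) where

  -- One name per edge, so that the size of a row becomes the length of a list without repetitions.
  names : ℕ → ℕ → List (Kind × ℕ)
  names q zero    = []
  names q (suc m) = map (_, q) (kindsOf (Y q)) ++ names (suc q) m

  length-names : ∀ q m → length (names q m) ≡ size (segment Y q m)
  length-names q zero    = refl
  length-names q (suc m) = trans (length-++ (map (_, q) (kindsOf (Y q))))
    (cong₂ _+_ (trans (length-map _ (kindsOf (Y q))) (length-kindsOf (Y q))) (length-names (suc q) m))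

  ∈-names⁺ : ∀ q m {k} i → i < m → T (contains k (Y (q + i))) → (k , q + i) ∈ names q m
  ∈-names⁺ q (suc m) {k} zero    _ c rewrite +-identityʳ q = ∈-++⁺ˡ (∈-map⁺ (_, q) (∈-kindsOf k (Y q) c))
  ∈-names⁺ q (suc m) {k} (suc i) (s≤s i<m) c rewrite +-suc q i =
    ∈-++⁺ʳ (map (_, q) (kindsOf (Y q))) (∈-names⁺ (suc q) m i i<m c)

  ∈-names⁻ : ∀ q m {k i} → (k , i) ∈ names q m → q ≤ i × i < q + m × T (contains k (Y i))
  ∈-names⁻ q (suc m) p with ∈-++⁻ (map (_, q) (kindsOf (Y q))) p
  ... | inj₁ r with k , k∈ , refl ← ∈-map⁻ (_, q) r = ≤-refl , m<m+n q z<s , kindsOf⁻ k (Y q) k∈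
  ... | inj₂ r = let lo , hi , c = ∈-names⁻ (suc q) m r in
    <⇒≤ lo , ≤-trans hi (≤-reflexive (sym (+-suc q m))) , c

  names-unique : ∀ q m → Unique (names q m)
  names-unique q zero    = []
  names-unique q (suc m) = AllPairs.++⁺
    (AllPairs.map⁺ (AllPairs.map (λ k≢l → k≢l ∘ cong proj₁) (kindsOf-unique (Y q))))
    (names-unique (suc q) m)
    (All.map⁺ (All.tabulate λ _ → All.tabulate λ { p∈ refl → <-irrefl refl (proj₁ (∈-names⁻ (suc q) m p∈)) }))

≼-antisym : ∀ {c d} → c ≼ d → d ≼ c → c ≡ d
≼-antisym {c} {d} = from-yes
  (allCols? λ c → allCols? λ d → (c ≼? d) →-dec ((d ≼? c) →-dec (c ≟ᶜ d))) c d

spoke-alone : ∀ {c} → T (contains rung c) → ¬ T (contains uu c) × ¬ T (contains vv c)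
spoke-alone {spoke} _ = id , id

exactlyOne⁺ : ∀ {p q r} → T p ⊎ T q ⊎ T r → ¬ (T p × T q) → ¬ (T p × T r) → ¬ (T q × T r) →
  T (exactlyOne p q r)
exactlyOne⁺ {true} {true} _ ¬pq _ _ = ¬pq _
exactlyOne⁺ {true} {false} {true} _ _ ¬pr _ = ¬pr _
exactlyOne⁺ {true} {false} {false} _ _ _ _ = _
exactlyOne⁺ {false} {true} {true} _ _ _ ¬qr = ¬qr _
exactlyOne⁺ {false} {true} {false} _ _ _ _ = _
exactlyOne⁺ {false} {false} {true} _ _ _ _ = _
exactlyOne⁺ {false} {false} {false} (inj₁ ()) _ _ _
exactlyOne⁺ {false} {false} {false} (inj₂ (inj₁ ())) _ _ _
exactlyOne⁺ {false} {false} {false} (inj₂ (inj₂ ())) _ _ _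

exactlyOne⁻ : ∀ p q r → T (exactlyOne p q r) →
  (T p × ¬ T q × ¬ T r) ⊎ (¬ T p × T q × ¬ T r) ⊎ (¬ T p × ¬ T q × T r)
exactlyOne⁻ true  false false _ = inj₁ (_ , id , id)
exactlyOne⁻ false true  false _ = inj₂ (inj₁ (id , _ , id))
exactlyOne⁻ false false true  _ = inj₂ (inj₂ (id , id , _))

-- A rung takes precedence, so other edges beside a rung are lost; hence the hypothesis of
-- `column-complete`.
column : Bool → Bool → Bool → Col
column true  _     _     = spoke
column false true  true  = both
column false true  false = onlyU
column false false true  = onlyV
column false false false = none

select : {A : Set} → Kind → A → A → A → A
select rung p q r = p
select uu   p q r = q
select vv   p q r = r

column-sound : ∀ k p q r → T (contains k (column p q r)) → T (select k p q r)
column-sound rung true  _     _     _ = _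
column-sound uu   false true  true  _ = _
column-sound uu   false true  false _ = _
column-sound vv   false true  true  _ = _
column-sound vv   false false true  _ = _
column-sound rung false true  true  ()
column-sound rung false true  false ()
column-sound rung false false true  ()
column-sound rung false false false ()
column-sound vv   false true  false ()

column-complete : ∀ k p q r → (T p → ¬ T q × ¬ T r) → T (select k p q r) → T (contains k (column p q r))
column-complete rung true  _     _     _ _ = _
column-complete uu   true  true  _     f _ = proj₁ (f _) _
column-complete uu   false true  true  _ _ = _
column-complete uu   false true  false _ _ = _
column-complete vv   true  _     true  f _ = proj₂ (f _) _
column-complete vv   false true  true  _ _ = _
column-complete vv   false false true  _ _ = _

anyKind? : {P : Kind → Set} → (∀ k → Dec (P k)) → Dec (∃ P)
anyKind? P? = map′
  (λ { (inj₁ p) → rung , p ; (inj₂ (inj₁ p)) → uu , p ; (inj₂ (inj₂ p)) → vv , p })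
  (λ { (rung , p) → inj₁ p ; (uu , p) → inj₂ (inj₁ p) ; (vv , p) → inj₂ (inj₂ p) })
  (P? rung ⊎-dec P? uu ⊎-dec P? vv)

_≟ᵥ_ : ∀ {n} (x y : Vertexₚ n) → Dec (x ≡ y)
uᶠ i ≟ᵥ uᶠ j = map′ (cong uᶠ) (λ { refl → refl }) (i Fin.≟ j)
uᶠ i ≟ᵥ vᶠ j = no λ ()
vᶠ i ≟ᵥ uᶠ j = no λ ()
vᶠ i ≟ᵥ vᶠ j = map′ (cong vᶠ) (λ { refl → refl }) (i Fin.≟ j)

-- Tiles inside matchings

-- An empty cut admits only `spoke` or `both`; after `both` each of the next three columns has a
-- single choice.
tile-step : ∀ {s c₀ c₁ c₂ c₃} → s ≡ empty → T (fits s c₀) → T (fits (next s c₀) c₁) →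
  T (fits (next (next s c₀) c₁) c₂) → T (fits (next (next (next s c₀) c₁) c₂) c₃) →
  (c₀ ≡ spoke × next s c₀ ≡ empty) ⊎
  (c₀ ∷ c₁ ∷ c₂ ∷ c₃ ∷ [] ≡ ⟦ B ∷ [] ⟧ × next (next (next (next s c₀) c₁) c₂) c₃ ≡ empty)
tile-step {c₀ = c₀} {c₁} {c₂} {c₃} refl f₀ f₁ f₂ f₃ = check c₀ f₀ c₁ f₁ c₂ f₂ c₃ f₃
  where
  check = from-yes (
    allCols? λ c₀ → T? (fits empty c₀) →-dec (
    allCols? λ c₁ → T? (fits (next empty c₀) c₁) →-dec (
    allCols? λ c₂ → T? (fits (next (next empty c₀) c₁) c₂) →-dec (
    allCols? λ c₃ → T? (fits (next (next (next empty c₀) c₁) c₂) c₃) →-dec (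
    ((c₀ ≟ᶜ spoke) ×-dec (next empty c₀ ≟ˢ empty)) ⊎-dec
    ((c₀ ∷ c₁ ∷ c₂ ∷ c₃ ∷ []) ≟ᶜˢ ⟦ B ∷ [] ⟧) ×-dec
    (next (next (next (next empty c₀) c₁) c₂) c₃ ≟ˢ empty))))))

-- The cut after a spoke that is crossed by uᵢ₋₁uᵢ₊₁.
crossing : Cut
crossing = true , false , false

crossing-step : ∀ {s c₀ c₁ c₂ c₃} → s ≡ crossing → T (fits s c₀) → T (fits (next s c₀) c₁) →
  T (fits (next (next s c₀) c₁) c₂) → T (fits (next (next (next s c₀) c₁) c₂) c₃) →
  c₀ ≢ spoke × c₁ ≢ spoke × (c₂ ≡ spoke ⊎ (c₂ ≢ spoke × c₃ ≢ spoke × next (next (next (next s c₀) c₁) c₂) c₃ ≡ crossing))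
crossing-step {c₀ = c₀} {c₁} {c₂} {c₃} refl f₀ f₁ f₂ f₃ = check c₀ f₀ c₁ f₁ c₂ f₂ c₃ f₃
  where
  spoke? : ∀ c → Dec (c ≡ spoke)
  spoke? c = c ≟ᶜ spoke
  check = from-yes (
    allCols? λ c₀ → T? (fits crossing c₀) →-dec (
    allCols? λ c₁ → T? (fits (next crossing c₀) c₁) →-dec (
    allCols? λ c₂ → T? (fits (next (next crossing c₀) c₁) c₂) →-dec (
    allCols? λ c₃ → T? (fits (next (next (next crossing c₀) c₁) c₂) c₃) →-dec (
    ¬? (spoke? c₀) ×-dec ¬? (spoke? c₁) ×-dec (spoke? c₂ ⊎-dec ¬? (spoke? c₂) ×-dec ¬? (spoke? c₃) ×-dec
      (next (next (next (next crossing c₀) c₁) c₂) c₃ ≟ˢ crossing)))))))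

-- A spoke uses uᵢ and vᵢ, so the cut before it can be crossed only by uᵢ₋₁uᵢ₊₁, which then crosses
-- the cut after it too.
cut-before-spoke : ∀ {s c} → c ≡ spoke → T (fits s c) → s ≡ empty ⊎ next s c ≡ crossing
cut-before-spoke {false , false , false} refl _ = inj₁ refl
cut-before-spoke {false , true  , false} refl _ = inj₂ refl

-- The four edges of a block cover all eight vertices of its columns, so no further edge fits and
-- neither end cut is crossed.
block-rigid : Rigid ⟦ B ∷ [] ⟧ ⟦ B ∷ [] ⟧
block-rigid = from-yes (rigid? ⟦ B ∷ [] ⟧ ⟦ B ∷ [] ⟧)

module _ {Y : ℕ → Col} (fits : ∀ j → Fits Y j) where

  tile-at : ∀ j → cut Y j ≡ empty → (Y (2 + j) ≡ spoke × cut Y (1 + j) ≡ empty) ⊎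
    (segment Y (2 + j) 4 ≡ ⟦ B ∷ [] ⟧ × cut Y (4 + j) ≡ empty)
  tile-at j e = tile-step e (fits j) (fits (1 + j)) (fits (2 + j)) (fits (3 + j))

  -- The spoke just after the segment prevents the last block from overrunning it.
  tiling : ∀ m j → cut Y j ≡ empty → Y (2 + j + m) ≡ spoke → ∃[ w ] ⟦ w ⟧ ≡ segment Y (2 + j) m
  tiling zero j e end = [] , refl
  tiling (suc m) j e end with tile-at j e
  ... | inj₁ (sp , e′) =
    let w , eq = tiling m (1 + j) e′ (trans (cong Y (sym (+-suc (2 + j) m))) end)
    in S ∷ w , cong₂ _∷_ (sym sp) eq
  ... | inj₂ (bl , e′) = continue m bl e′ end
    where
    continue : ∀ m → segment Y (2 + j) 4 ≡ ⟦ B ∷ [] ⟧ → cut Y (4 + j) ≡ empty →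
      Y (2 + j + suc m) ≡ spoke → ∃[ w ] ⟦ w ⟧ ≡ segment Y (2 + j) (suc m)
    continue 0 bl e′ end = contradiction (trans (sym (cong (λ cs → nth cs 1) bl)) (trans (cong Y (+-comm 1 (2 + j))) end)) λ ()
    continue 1 bl e′ end = contradiction (trans (sym (cong (λ cs → nth cs 2) bl)) (trans (cong Y (+-comm 2 (2 + j))) end)) λ ()
    continue 2 bl e′ end = contradiction (trans (sym (cong (λ cs → nth cs 3) bl)) (trans (cong Y (+-comm 3 (2 + j))) end)) λ ()
    continue (suc (suc (suc m))) bl e′ end =
      let w , eq = tiling m (4 + j) e′ (trans (cong Y (trans (cong (_+ m) (+-comm 4 (2 + j))) (+-assoc (2 + j) 4 m))) end)
      in B ∷ w , trans (cong (_++ ⟦ w ⟧) (sym bl)) (cong (segment Y (2 + j) 4 ++_) eq)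

  -- A crossed spoke is followed by blocks onlyV, onlyU, both, none; the next
  -- spoke comes after the second column of one of them.
  crossed : ∀ {p} → (∀ i → p < i → Y i ≡ spoke → (∀ k → p < k → k < i → Y k ≢ spoke) → 4 ∣ (i ∸ p ∸ 1)) →
    ∀ f d j → 4 ∣ d → 2 + j ≡ p + suc d → cut Y j ≡ crossing →
    (∀ k → p < k → k < 2 + j → Y k ≢ spoke) → Y (f + (2 + j)) ≢ spoke
  crossed {p} gap f d j 4∣d q≡ e none-before end
    with c₀ , c₁ , rest ← crossing-step e (fits j) (fits (1 + j)) (fits (2 + j)) (fits (3 + j))
    = go f end rest
    where
    before₂ : ∀ k → p < k → k < 4 + j → Y k ≢ spoke
    before₂ k p<k k< with m≤n⇒m<n∨m≡n k<
    ... | inj₂ refl = c₁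
    ... | inj₁ k<₁ with m≤n⇒m<n∨m≡n (s≤s⁻¹ k<₁)
    ...   | inj₂ refl = c₀
    ...   | inj₁ k<₂ = none-before k p<k (s≤s⁻¹ k<₂)
    contra : Y (4 + j) ≢ spoke
    contra sp = 4∤2 (∣m+n∣m⇒∣n {m = d} (subst (4 ∣_) width
        (gap (4 + j) (subst (p <_) (cong (2 +_) (sym q≡)) (≤-trans (m<m+n p z<s) (m≤n+m _ 2))) sp before₂)) 4∣d)
      where
      4∤2 : ¬ 4 ∣ 2
      4∤2 d∣ = <⇒≱ {2} {4} (s≤s (s≤s (s≤s z≤n))) (∣⇒≤ d∣)
      width : 4 + j ∸ p ∸ 1 ≡ d + 2
      width = begin
        4 + j ∸ p ∸ 1              ≡⟨ cong (λ q → 2 + q ∸ p ∸ 1) q≡ ⟩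
        2 + (p + suc d) ∸ p ∸ 1    ≡⟨ cong (λ q → q ∸ p ∸ 1) (+-comm 2 (p + suc d)) ⟩
        p + suc d + 2 ∸ p ∸ 1      ≡⟨ cong (λ q → q ∸ p ∸ 1) (+-assoc p (suc d) 2) ⟩
        p + (suc d + 2) ∸ p ∸ 1    ≡⟨ cong (_∸ 1) (m+n∸m≡n p (suc d + 2)) ⟩
        d + 2                      ∎
        where open ≡-Reasoning
    -- Here `f` is the distance to the supposed spoke and `d` the number of columns already passed
    -- since `p`.
    go : ∀ f → Y (f + (2 + j)) ≡ spoke →
      ¬ (Y (4 + j) ≡ spoke ⊎ (Y (4 + j) ≢ spoke × Y (5 + j) ≢ spoke × cut Y (4 + j) ≡ crossing))
    go 0 end _ = c₀ end
    go 1 end _ = c₁ end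
    go f end (inj₁ sp) = contra sp
    go 2 end _ = contra end
    go 3 end (inj₂ (_ , c₃ , _)) = c₃ end
    go (suc (suc (suc (suc f)))) end (inj₂ (c₂ , c₃ , e′)) =
      crossed gap f (4 + d) (4 + j) (∣m∣n⇒∣m+n ∣-refl 4∣d)
        (trans (cong (4 +_) q≡) (trans (+-comm 4 (p + suc d)) (trans (+-assoc p (suc d) 4) (cong (λ t → p + suc t) (+-comm d 4)))))
        e′ before₄
        (trans (cong Y (trans (cong (λ t → f + t) (+-comm 4 (2 + j))) (trans (sym (+-assoc f (2 + j) 4)) (+-comm (f + (2 + j)) 4)))) end)
      where
      before₄ : ∀ k → p < k → k < 6 + j → Y k ≢ spoke
      before₄ k p<k k< with m≤n⇒m<n∨m≡n k<
      ... | inj₂ refl = c₃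
      ... | inj₁ k<₁ with m≤n⇒m<n∨m≡n (s≤s⁻¹ k<₁)
      ...   | inj₂ refl = c₂
      ...   | inj₁ k<₂ = before₂ k p<k (s≤s⁻¹ k<₂)

-- The second disjunct covers the spoke that follows cyclically when w starts with S.
uncrossed : ∀ w i → nth ⟦ w ⟧ (suc i) ≡ spoke ⊎ suc i ≡ length ⟦ w ⟧ → ¬ T (contains uu (nth ⟦ w ⟧ i))
uncrossed (S ∷ w) zero _ ()
uncrossed (S ∷ w) (suc i) (inj₁ e) = uncrossed w i (inj₁ e)
uncrossed (S ∷ w) (suc i) (inj₂ e) = uncrossed w i (inj₂ (suc-injective e))
uncrossed (B ∷ w) 0 (inj₁ ())
uncrossed (B ∷ w) 0 (inj₂ ())
uncrossed (B ∷ w) 1 (inj₁ ())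
uncrossed (B ∷ w) 1 (inj₂ ())
uncrossed (B ∷ w) 2 _ ()
uncrossed (B ∷ w) 3 _ ()
uncrossed (B ∷ w) (suc (suc (suc (suc i)))) (inj₁ e) = uncrossed w i (inj₁ e)
uncrossed (B ∷ w) (suc (suc (suc (suc i)))) (inj₂ e) = uncrossed w i (inj₂ (+-cancelˡ-≡ 4 _ _ e))

-- The graph for n other than 4, with indices modulo n

module _ (n : ℕ) (n≥3 : 3 ≤ n) (n≢4 : n ≢ 4) where

  open Petersen n n≥3
  open FiniteSimpleGraph P

  infix 4 _≈_

  _≈_ : ℕ → ℕ → Set
  i ≈ j = i mod n ≡ j mod n

  toℕ-mod : ∀ i → toℕ (i mod n) ≡ i % n
  toℕ-mod i = toℕ-fromℕ< (m%n<n i n)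

  %⇒≈ : ∀ {i j} → i % n ≡ j % n → i ≈ j
  %⇒≈ {i} {j} e = toℕ-injective (trans (toℕ-mod i) (trans e (sym (toℕ-mod j))))

  ≈⇒% : ∀ {i j} → i ≈ j → i % n ≡ j % n
  ≈⇒% {i} {j} e = trans (sym (toℕ-mod i)) (trans (cong toℕ e) (toℕ-mod j))

  %-≈ : ∀ i → i % n ≈ i
  %-≈ i = %⇒≈ (m%n%n≡m%n i n)

  +-≈ : ∀ {i j} d → i ≈ j → i + d ≈ j + d
  +-≈ {i} {j} d e = %⇒≈ (trans (%-distribˡ-+ i d n)
    (trans (cong (λ r → (r + d % n) % n) (≈⇒% e)) (sym (%-distribˡ-+ j d n))))

  +n-≈ : ∀ i → i + n ≈ i
  +n-≈ i = %⇒≈ ([m+n]%n≡m%n i n)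

  ≈-cancel : ∀ {i j} d → d ≤ n → i + d ≈ j + d → i ≈ j
  ≈-cancel {i} {j} d d≤n e = trans (sym (back i)) (trans (+-≈ (n ∸ d) e) (back j))
    where
    back : ∀ i → i + d + (n ∸ d) ≈ i
    back i = trans (cong (_mod n) (trans (+-assoc i d _) (cong (i +_) (m+[n∸m]≡n d≤n)))) (+n-≈ i)

  ≈-shift : ∀ i d → i + d ≈ i → n ∣ d
  ≈-shift i d e = ∣m+n∣m⇒∣n
    (divides ((i + d) / n) (+-cancelˡ-≡ (i % n) _ _ (begin
      i % n + (i / n * n + d)            ≡⟨ +-assoc (i % n) _ d ⟨
      i % n + i / n * n + d              ≡⟨ cong (_+ d) (m≡m%n+[m/n]*n i n) ⟨
      i + d                              ≡⟨ m≡m%n+[m/n]*n (i + d) n ⟩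
      (i + d) % n + (i + d) / n * n      ≡⟨ cong (_+ (i + d) / n * n) (≈⇒% e) ⟩
      i % n + (i + d) / n * n            ∎)))
    (divides (i / n) refl)
    where open ≡-Reasoning

  n∤2 : ¬ n ∣ 2
  n∤2 d = <⇒≱ n≥3 (∣⇒≤ d)

  -- Keeps the edges uᵢuᵢ₊₂ and uᵢ₊₂uᵢ₊₄ apart.
  n∤4 : ¬ n ∣ 4
  n∤4 d = case m≤n⇒m<n∨m≡n n≥3 of λ
    { (inj₁ n≥4) → n≢4 (≤-antisym (∣⇒≤ d) n≥4)
    ; (inj₂ refl) → case d of λ { (divides 0 ()) ; (divides 1 ()) ; (divides (suc (suc q)) ()) } }

  Periodic : (ℕ → Col) → Set
  Periodic Y = ∀ {i j} → i ≈ j → Y i ≡ Y j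

  ends : Kind → ℕ → Vertex × Vertex
  ends rung i = u i , v i
  ends uu   i = u i , u (i + 2)
  ends vv   i = v i , v (i + 1)

  ends-cong : ∀ k {i j} → i ≈ j → ends k i ≡ ends k j
  ends-cong rung e = cong₂ _,_ (cong uᶠ e) (cong vᶠ e)
  ends-cong uu   e = cong₂ _,_ (cong uᶠ e) (cong uᶠ (+-≈ 2 e))
  ends-cong vv   e = cong₂ _,_ (cong vᶠ e) (cong vᶠ (+-≈ 1 e))

  Joins : Kind → ℕ → Vertex → Vertex → Set
  Joins k i x y = (x , y) ≡ ends k i ⊎ (y , x) ≡ ends k i

  joins-cong : ∀ k {i j x y} → i ≈ j → Joins k i x y → Joins k j x y
  joins-cong k e (inj₁ p) = inj₁ (trans p (ends-cong k e))
  joins-cong k e (inj₂ p) = inj₂ (trans p (ends-cong k e))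

  joins-sym : ∀ {k i x y} → Joins k i x y → Joins k i y x
  joins-sym (inj₁ p) = inj₂ p
  joins-sym (inj₂ p) = inj₁ p

  joins-functional : ∀ {k i x y z} → Joins k i x y → Joins k i x z → y ≡ z
  joins-functional (inj₁ p) (inj₁ q) = cong proj₂ (trans p (sym q))
  joins-functional (inj₂ p) (inj₂ q) = cong proj₁ (trans p (sym q))
  joins-functional (inj₁ p) (inj₂ q) with refl ← trans p (sym q) = refl
  joins-functional (inj₂ p) (inj₁ q) with refl ← trans p (sym q) = refl

  u-injective : ∀ {i j} → _≡_ {A = Vertex} (u i) (u j) → i ≈ j
  u-injective = λ e → inj e
    where
    inj : ∀ {i j : Fin n} → uᶠ i ≡ uᶠ j → i ≡ j
    inj refl = refl

  v-injective : ∀ {i j} → _≡_ {A = Vertex} (v i) (v j) → i ≈ j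
  v-injective = λ e → inj e
    where
    inj : ∀ {i j : Fin n} → vᶠ i ≡ vᶠ j → i ≡ j
    inj refl = refl

  ends-injective : ∀ k k′ {i j} → ends k i ≡ ends k′ j → k ≡ k′ × i ≈ j
  ends-injective rung rung e = refl , u-injective (cong proj₁ e)
  ends-injective uu   uu   e = refl , u-injective (cong proj₁ e)
  ends-injective vv   vv   e = refl , v-injective (cong proj₁ e)
  ends-injective rung uu   e with () ← cong proj₂ e
  ends-injective rung vv   e with () ← cong proj₁ e
  ends-injective uu   rung e with () ← cong proj₂ e
  ends-injective uu   vv   e with () ← cong proj₁ e
  ends-injective vv   rung e with () ← cong proj₁ e
  ends-injective vv   uu   e with () ← cong proj₁ e

  -- For two edges of kind `uu` or two of kind `vv`, agreement after reversal would give `n ∣ 4` or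
  -- `n ∣ 2`. Thus an edge has one name, whichever way it is read.
  ends-oriented : ∀ k k′ {i j} → ends k i ≢ swap (ends k′ j)
  ends-oriented rung rung e with () ← cong proj₁ e
  ends-oriented rung uu   e with () ← cong proj₂ e
  ends-oriented rung vv   e with () ← cong proj₁ e
  ends-oriented uu   rung e with () ← cong proj₁ e
  ends-oriented uu   vv   e with () ← cong proj₁ e
  ends-oriented vv   rung e with () ← cong proj₂ e
  ends-oriented vv   uu   e with () ← cong proj₁ e
  ends-oriented uu   uu {i} {j} e = n∤4 (≈-shift j 4
    (trans (cong (_mod n) (sym (+-assoc j 2 2)))
      (trans (+-≈ 2 (sym (u-injective (cong proj₁ e)))) (u-injective (cong proj₂ e)))))
  ends-oriented vv   vv {i} {j} e = n∤2 (≈-shift j 2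
    (trans (cong (_mod n) (sym (+-assoc j 1 1)))
      (trans (+-≈ 1 (sym (v-injective (cong proj₁ e)))) (v-injective (cong proj₂ e)))))

  joins-injective : ∀ {k k′ i j x y} → Joins k i x y → Joins k′ j x y → k ≡ k′ × i ≈ j
  joins-injective (inj₁ p) (inj₁ q) = ends-injective _ _ (trans (sym p) q)
  joins-injective (inj₂ p) (inj₂ q) = ends-injective _ _ (trans (sym p) q)
  joins-injective {k} {k′} (inj₁ p) (inj₂ q) = contradiction (trans (sym p) (cong swap q)) (ends-oriented k k′)
  joins-injective {k} {k′} (inj₂ p) (inj₁ q) = contradiction (trans (sym p) (cong swap q)) (ends-oriented k k′)

  at-u : ∀ {k i y} j → Joins k i (u (2 + j)) y →
    (k ≡ rung × i ≈ 2 + j) ⊎ (k ≡ uu × i ≈ 2 + j) ⊎ (k ≡ uu × i ≈ j)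
  at-u {rung} j (inj₁ e) = inj₁ (refl , sym (u-injective (cong proj₁ e)))
  at-u {rung} j (inj₂ e) with () ← cong proj₂ e
  at-u {uu}   j (inj₁ e) = inj₂ (inj₁ (refl , sym (u-injective (cong proj₁ e))))
  at-u {uu} {i} j (inj₂ e) = inj₂ (inj₂ (refl , sym (≈-cancel 2 (<⇒≤ n≥3)
    (trans (cong (_mod n) (+-comm j 2)) (u-injective (cong proj₂ e))))))
  at-u {vv}   j (inj₁ e) with () ← cong proj₁ e
  at-u {vv}   j (inj₂ e) with () ← cong proj₂ e

  at-v : ∀ {k i y} j → Joins k i (v (2 + j)) y →
    (k ≡ rung × i ≈ 2 + j) ⊎ (k ≡ vv × i ≈ 2 + j) ⊎ (k ≡ vv × i ≈ 1 + j)
  at-v {rung} j (inj₁ e) with () ← cong proj₁ e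
  at-v {rung} j (inj₂ e) = inj₁ (refl , sym (v-injective (cong proj₂ e)))
  at-v {vv}   j (inj₁ e) = inj₂ (inj₁ (refl , sym (v-injective (cong proj₁ e))))
  at-v {vv} {i} j (inj₂ e) = inj₂ (inj₂ (refl , sym (≈-cancel 1 (<⇒≤ (<⇒≤ n≥3))
    (trans (cong (_mod n) (+-comm (1 + j) 1)) (v-injective (cong proj₂ e))))))
  at-v {uu}   j (inj₁ e) with () ← cong proj₁ e
  at-v {uu}   j (inj₂ e) with () ← cong proj₂ e

  ∈-edgeList⁺ : ∀ k i → ends k i ∈ edgeList
  ∈-edgeList⁺ k i = subst (_∈ edgeList) (ends-cong k (%-≈ i))
    (∈-concatMap⁺ _ (lose (∈-upTo⁺ (m%n<n i n)) (listed k)))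
    where
    listed : ∀ k {i} → ends k i ∈ (u i , u (i + 2)) ∷ (u i , v i) ∷ (v i , v (i + 1)) ∷ []
    listed uu   = here refl
    listed rung = there (here refl)
    listed vv   = there (there (here refl))

  ∈-edgeList⁻ : ∀ {e} → e ∈ edgeList → ∃[ k ] ∃[ i ] e ≡ ends k i
  ∈-edgeList⁻ p with i , _ , q ← find (∈-concatMap⁻ _ {xs = upTo n} p) | q
  ... | here e                 = uu , i , e
  ... | there (here e)         = rung , i , e
  ... | there (there (here e)) = vv , i , e

  joins⇒~ : ∀ {k i x y} → Joins k i x y → x ~ y
  joins⇒~ {k} {i} (inj₁ refl) = inj₁ (∈-edgeList⁺ k i)
  joins⇒~ {k} {i} (inj₂ refl) = inj₂ (∈-edgeList⁺ k i)

  ~⇒joins : ∀ {x y} → x ~ y → ∃[ k ] ∃[ i ] Joins k i x y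
  ~⇒joins (inj₁ p) = let k , i , e = ∈-edgeList⁻ p in k , i , inj₁ e
  ~⇒joins (inj₂ p) = let k , i , e = ∈-edgeList⁻ p in k , i , inj₂ e

  -- Edge sets as column sequences

  Member : EdgeSet → Kind → ℕ → Set
  Member M k i = T (uncurry (has M) (ends k i))

  joins⇒member : ∀ M {k i x y} → Joins k i x y → x – y ∈ₑ M → Member M k i
  joins⇒member M (inj₁ refl) h = h
  joins⇒member M (inj₂ refl) h = has-sym M h

  member⇒joins : ∀ M {k i x y} → Joins k i x y → Member M k i → x – y ∈ₑ M
  member⇒joins M (inj₁ refl) h = h
  member⇒joins M (inj₂ refl) h = has-sym M h

  cols : EdgeSet → ℕ → Col
  cols M i = column (has M (u i) (v i)) (has M (u i) (u (i + 2))) (has M (v i) (v (i + 1)))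

  cols-periodic : ∀ M → Periodic (cols M)
  cols-periodic M {i} {j} e
    rewrite cong uᶠ e | cong vᶠ e | cong uᶠ (+-≈ {i} {j} 2 e) | cong vᶠ (+-≈ {i} {j} 1 e) = refl

  -- The condition under which `cols` loses no edge. It holds for matchings and passes to subsets,
  -- hence to forcing sets.
  SpokesAlone : EdgeSet → Set
  SpokesAlone M = ∀ i → Member M rung i → ¬ Member M uu i × ¬ Member M vv i

  member⁺ : ∀ M k i → T (contains k (cols M i)) → Member M k i
  member⁺ M rung i = column-sound rung _ _ _
  member⁺ M uu   i = column-sound uu (has M (u i) (v i)) _ _
  member⁺ M vv   i = column-sound vv (has M (u i) (v i)) (has M (u i) (u (i + 2))) _

  member⁻ : ∀ M → SpokesAlone M → ∀ k i → Member M k i → T (contains k (cols M i))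
  member⁻ M alone rung i = column-complete rung _ _ _ (alone i)
  member⁻ M alone uu   i = column-complete uu _ _ _ (alone i)
  member⁻ M alone vv   i = column-complete vv _ _ _ (alone i)

  joins? : ∀ k i x y → Dec (Joins k i x y)
  joins? k i x y = (x , y) ≟ₑ ends k i ⊎-dec (y , x) ≟ₑ ends k i
    where _≟ₑ_ = ×-≡-dec _≟ᵥ_ _≟ᵥ_

  module _ (Y : ℕ → Col) where

    -- Indices from `Fin n` make this decidable; periodicity of `Y` restores arbitrary indices in
    -- `edgeSet⁺`.
    Spans : Vertex → Vertex → Set
    Spans x y = ∃[ i ] ∃[ k ] T (contains k (Y (toℕ i))) × Joins k (toℕ {n} i) x y

    spans? : ∀ x y → Dec (Spans x y)
    spans? x y = any? λ i → anyKind? λ k → T? _ ×-dec joins? k (toℕ i) x y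

    edgeSet : EdgeSet
    edgeSet = record
      { has     = λ x y → ⌊ spans? x y ⌋
      ; has-sym = λ {x} {y} h → let i , k , c , j = toWitness {a? = spans? x y} h in
          fromWitness {a? = spans? y x} (i , k , c , joins-sym j)
      ; has⇒~   = λ {x} {y} h → let i , k , c , j = toWitness {a? = spans? x y} h in joins⇒~ j
      }

    edgeSet⁻ : ∀ {x y} → x – y ∈ₑ edgeSet → ∃[ k ] ∃[ i ] T (contains k (Y i)) × Joins k i x y
    edgeSet⁻ {x} {y} h = let i , k , c , j = toWitness {a? = spans? x y} h in k , toℕ i , c , j

    edgeSet⁺ : Periodic Y → ∀ {k i x y} → T (contains k (Y i)) → Joins k i x y → x – y ∈ₑ edgeSet
    edgeSet⁺ per {k} {i} {x} {y} c j = fromWitness {a? = spans? x y}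
      (i mod n , k , subst (T ∘ contains k) (per (sym e)) c , joins-cong k (sym e) j)
      where
      e : toℕ (i mod n) ≈ i
      e = trans (cong (_mod n) (toℕ-mod i)) (%-≈ i)

    edgeSet-member : Periodic Y → ∀ k i → Member edgeSet k i → T (contains k (Y i))
    edgeSet-member per k i h
      with k′ , i′ , c , j ← edgeSet⁻ h
      with refl , e ← joins-injective {k} {k′} {i} (inj₁ refl) j = subst (T ∘ contains k) (per (sym e)) c

    edgeSet-alone : Periodic Y → SpokesAlone edgeSet
    edgeSet-alone per i h = let f , g = spoke-alone (edgeSet-member per rung i h) in
      f ∘ edgeSet-member per uu i , g ∘ edgeSet-member per vv i

    cols-edgeSet : Periodic Y → ∀ i → cols edgeSet i ≡ Y i
    cols-edgeSet per i = ≼-antisym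
      (λ k c → edgeSet-member per k i (member⁺ edgeSet k i c))
      (λ k c → member⁻ edgeSet (edgeSet-alone per) k i (edgeSet⁺ per c (inj₁ refl)))

  has⇒contains : ∀ M → SpokesAlone M → ∀ {x y} → x – y ∈ₑ M →
    ∃[ k ] ∃[ i ] T (contains k (cols M i)) × Joins k i x y
  has⇒contains M alone h = let k , i , j = ~⇒joins (has⇒~ M h) in
    k , i , member⁻ M alone k i (joins⇒member M j h) , j

  contains⇒has : ∀ M {k i x y} → T (contains k (cols M i)) → Joins k i x y → x – y ∈ₑ M
  contains⇒has M {k} {i} c j = member⇒joins M j (member⁺ M k i c)

  alone-⊆ : ∀ {M N} → N ⊆ₑ M → SpokesAlone M → SpokesAlone N
  alone-⊆ sub alone i h = let f , g = alone i (sub h) in f ∘ sub , g ∘ sub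

  ≼⇒⊆ : ∀ M N → SpokesAlone M → (∀ i → cols M i ≼ cols N i) → M ⊆ₑ N
  ≼⇒⊆ M N alone f h = let k , i , c , j = has⇒contains M alone h in contains⇒has N (f i k c) j

  same-name : ∀ {M k k′ i i′ x y y′} → IsPerfectMatching M →
    Joins k i x y → Joins k′ i′ x y′ → Member M k i → Member M k′ i′ → k ≡ k′ × i ≈ i′
  same-name {M} {x = x} pm j j′ h h′
    with _ , _ , uniq ← pm x
    with refl ← uniq (member⇒joins M j h) | refl ← uniq (member⇒joins M j′ h′) = joins-injective j j′

  matching-alone : ∀ {M} → IsPerfectMatching M → SpokesAlone M
  matching-alone {M} pm i h =
    (λ h′ → case same-name {M} {rung} {uu} {i} {i} pm (inj₁ refl) (inj₁ refl) h h′ of λ { (() , _) }) ,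
    (λ h′ → case same-name {M} {rung} {vv} {i} {i} pm (inj₂ refl) (inj₁ refl) h h′ of λ { (() , _) })

  -- A common form for the three edges at a u and at a v, so that each direction between matchings
  -- and `Fits` is argued once.
  Incident : Vertex → Kind → ℕ → Kind → ℕ → Kind → ℕ → Set
  Incident x k₁ i₁ k₂ i₂ k₃ i₃ =
    ∃ (Joins k₁ i₁ x) × ∃ (Joins k₂ i₂ x) × ∃ (Joins k₃ i₃ x) ×
    (∀ {k i y} → Joins k i x y → (k ≡ k₁ × i ≈ i₁) ⊎ (k ≡ k₂ × i ≈ i₂) ⊎ (k ≡ k₃ × i ≈ i₃))

  incident-u : ∀ j → Incident (u (2 + j)) rung (2 + j) uu (2 + j) uu j
  incident-u j = (_ , inj₁ refl) , (_ , inj₁ refl) ,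
    (u j , inj₂ (cong (λ t → u j , u t) (+-comm 2 j))) , at-u j

  incident-v : ∀ j → Incident (v (2 + j)) rung (2 + j) vv (2 + j) vv (1 + j)
  incident-v j = (_ , inj₂ refl) , (_ , inj₁ refl) ,
    (v (1 + j) , inj₂ (cong (λ t → v (1 + j) , v t) (+-comm 1 (1 + j)))) , at-v j

  exactlyOne-at : ∀ {M x k₁ i₁ k₂ i₂ k₃ i₃} → IsPerfectMatching M → Incident x k₁ i₁ k₂ i₂ k₃ i₃ →
    ¬ (k₁ ≡ k₂ × i₁ ≈ i₂) → ¬ (k₁ ≡ k₃ × i₁ ≈ i₃) → ¬ (k₂ ≡ k₃ × i₂ ≈ i₃) →
    T (exactlyOne (contains k₁ (cols M i₁)) (contains k₂ (cols M i₂)) (contains k₃ (cols M i₃)))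
  exactlyOne-at {M} {x} {k₁} {i₁} {k₂} {i₂} {k₃} {i₃} pm ((_ , j₁) , (_ , j₂) , (_ , j₃) , at) ¬12 ¬13 ¬23 =
    exactlyOne⁺ some (clash ¬12 j₁ j₂) (clash ¬13 j₁ j₃) (clash ¬23 j₂ j₃)
    where
    clash : ∀ {k i k′ i′ y y′} → ¬ (k ≡ k′ × i ≈ i′) → Joins k i x y → Joins k′ i′ x y′ →
      ¬ (T (contains k (cols M i)) × T (contains k′ (cols M i′)))
    clash ne j j′ (c , c′) = ne (same-name {M} pm j j′ (member⁺ M _ _ c) (member⁺ M _ _ c′))
    some : T (contains k₁ (cols M i₁)) ⊎ T (contains k₂ (cols M i₂)) ⊎ T (contains k₃ (cols M i₃))
    some with k , i , c , j ← has⇒contains M (matching-alone {M} pm) (proj₁ (proj₂ (pm x))) with at j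
    ... | inj₁ (refl , e)        = inj₁ (subst (T ∘ contains k) (cols-periodic M e) c)
    ... | inj₂ (inj₁ (refl , e)) = inj₂ (inj₁ (subst (T ∘ contains k) (cols-periodic M e) c))
    ... | inj₂ (inj₂ (refl , e)) = inj₂ (inj₂ (subst (T ∘ contains k) (cols-periodic M e) c))

  matching⇒fits : ∀ {M} → IsPerfectMatching M → ∀ j → Fits (cols M) j
  matching⇒fits {M} pm j = Equivalence.from T-∧
    ( exactlyOne-at {M} pm (incident-u j) (λ ()) (λ ())
        (λ (_ , e) → n∤2 (≈-shift j 2 (trans (cong (_mod n) (+-comm j 2)) e)))
    , exactlyOne-at {M} pm (incident-v j) (λ ()) (λ ())
        (λ (_ , e) → n∤1 (≈-shift (1 + j) 1 (trans (cong (_mod n) (+-comm (1 + j) 1)) e))))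
    where
    n∤1 : ¬ n ∣ 1
    n∤1 d = <⇒≱ n≥3 (≤-trans (∣⇒≤ d) (n≤1+n 1))

  partner-at : ∀ {Y x k₁ i₁ k₂ i₂ k₃ i₃} → Periodic Y → Incident x k₁ i₁ k₂ i₂ k₃ i₃ →
    T (exactlyOne (contains k₁ (Y i₁)) (contains k₂ (Y i₂)) (contains k₃ (Y i₃))) →
    ∃! _≡_ λ y → x – y ∈ₑ edgeSet Y
  partner-at {Y} {x} {k₁} {i₁} {k₂} {i₂} {k₃} {i₃} per ((y₁ , j₁) , (y₂ , j₂) , (y₃ , j₃) , at) one
    with exactlyOne⁻ (contains k₁ (Y i₁)) (contains k₂ (Y i₂)) (contains k₃ (Y i₃)) one
  ... | inj₁ (c , ¬c₂ , ¬c₃) = y₁ , edgeSet⁺ Y per c j₁ , λ h →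
    let k , i , c′ , j = edgeSet⁻ Y h in case at j of λ
      { (inj₁ (refl , e))        → joins-functional (joins-cong k₁ (sym e) j₁) j
      ; (inj₂ (inj₁ (refl , e))) → contradiction (subst (T ∘ contains k) (per e) c′) ¬c₂
      ; (inj₂ (inj₂ (refl , e))) → contradiction (subst (T ∘ contains k) (per e) c′) ¬c₃ }
  ... | inj₂ (inj₁ (¬c₁ , c , ¬c₃)) = y₂ , edgeSet⁺ Y per c j₂ , λ h →
    let k , i , c′ , j = edgeSet⁻ Y h in case at j of λ
      { (inj₁ (refl , e))        → contradiction (subst (T ∘ contains k) (per e) c′) ¬c₁
      ; (inj₂ (inj₁ (refl , e))) → joins-functional (joins-cong k₂ (sym e) j₂) j
      ; (inj₂ (inj₂ (refl , e))) → contradiction (subst (T ∘ contains k) (per e) c′) ¬c₃ }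
  ... | inj₂ (inj₂ (¬c₁ , ¬c₂ , c)) = y₃ , edgeSet⁺ Y per c j₃ , λ h →
    let k , i , c′ , j = edgeSet⁻ Y h in case at j of λ
      { (inj₁ (refl , e))        → contradiction (subst (T ∘ contains k) (per e) c′) ¬c₁
      ; (inj₂ (inj₁ (refl , e))) → contradiction (subst (T ∘ contains k) (per e) c′) ¬c₂
      ; (inj₂ (inj₂ (refl , e))) → joins-functional (joins-cong k₃ (sym e) j₃) j }

  2+-surjective : ∀ (i : Fin n) → ∃[ j ] i ≡ (2 + j) mod n
  2+-surjective i = toℕ i + (n ∸ 2) , sym (begin
    (2 + (toℕ i + (n ∸ 2))) mod n    ≡⟨ cong (_mod n) (+-assoc 2 (toℕ i) _) ⟨
    (2 + toℕ i + (n ∸ 2)) mod n      ≡⟨ cong (λ t → (t + (n ∸ 2)) mod n) (+-comm 2 (toℕ i)) ⟩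
    (toℕ i + 2 + (n ∸ 2)) mod n      ≡⟨ cong (_mod n) (+-assoc (toℕ i) 2 _) ⟩
    (toℕ i + (2 + (n ∸ 2))) mod n    ≡⟨ cong (λ t → (toℕ i + t) mod n) (m+[n∸m]≡n (<⇒≤ n≥3)) ⟩
    (toℕ i + n) mod n                ≡⟨ +n-≈ (toℕ i) ⟩
    toℕ i mod n                      ≡⟨ toℕ-injective (trans (toℕ-mod (toℕ i)) (m<n⇒m%n≡m (toℕ<n i))) ⟩
    i                                ∎)
    where open ≡-Reasoning

  fits⇒matching : ∀ {Y} → Periodic Y → (∀ j → Fits Y j) → IsPerfectMatching (edgeSet Y)
  fits⇒matching per fits (uᶠ i) with j , refl ← 2+-surjective i =
    partner-at per (incident-u j) (proj₁ (Equivalence.to T-∧ (fits j)))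
  fits⇒matching per fits (vᶠ i) with j , refl ← 2+-surjective i =
    partner-at per (incident-v j) (proj₂ (Equivalence.to T-∧ (fits j)))

  -- Cardinality

  -- Each edge has exactly one listed vertex pair and exactly one name with index below n; the
  -- pigeonhole principle is applied both ways.
  card≡size : ∀ M → SpokesAlone M → card M ≡ size (segment (cols M) 0 n)
  card≡size M alone = trans (≤-antisym
    (pigeonhole {R = λ p (k , i) → Joins k i (proj₁ p) (proj₂ p)} same-edge (names (cols M) 0 n)
      (AllPairs.filter⁺ (T? ∘ uncurry (has M)) (unorderedPairs-apart unique)) name-of)
    (pigeonhole {R = λ (k , i) p → Joins k i (proj₁ p) (proj₂ p) × i < n} {D = _≢_} distinct pairs
      (names-unique (cols M) 0 n) pair-of))
    (length-names (cols M) 0 n)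
    where
    pairs = filterᵇ (uncurry (has M)) (unorderedPairs vertices)
    same-edge : ∀ {p q : Vertex × Vertex} {e : Kind × ℕ} → Apart p q →
      Joins (proj₁ e) (proj₂ e) (proj₁ p) (proj₂ p) → ¬ Joins (proj₁ e) (proj₂ e) (proj₁ q) (proj₂ q)
    same-edge (ne , _) (inj₁ a) (inj₁ b) = ne (trans a (sym b))
    same-edge (_ , ne) (inj₁ a) (inj₂ b) = ne (trans a (sym b))
    same-edge (_ , ne) (inj₂ a) (inj₁ b) = ne (cong swap (trans a (sym b)))
    same-edge (ne , _) (inj₂ a) (inj₂ b) = ne (cong swap (trans a (sym b)))
    name-of : ∀ {p} → p ∈ pairs → ∃[ e ] e ∈ names (cols M) 0 n × Joins (proj₁ e) (proj₂ e) (proj₁ p) (proj₂ p)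
    name-of p∈ =
      let _ , h = ∈-filter⁻ (T? ∘ uncurry (has M)) {xs = unorderedPairs vertices} p∈
          k , i , c , j = has⇒contains M alone h
      in (k , i % n) , ∈-names⁺ (cols M) 0 n (i % n) (m%n<n i n)
           (subst (T ∘ contains k) (cols-periodic M (sym (%-≈ i))) c) , joins-cong k (sym (%-≈ i)) j
    distinct : ∀ {e f : Kind × ℕ} {p : Vertex × Vertex} → e ≢ f →
      Joins (proj₁ e) (proj₂ e) (proj₁ p) (proj₂ p) × proj₂ e < n →
      ¬ (Joins (proj₁ f) (proj₂ f) (proj₁ p) (proj₂ p) × proj₂ f < n)
    distinct ne (j , lt) (j′ , lt′) with refl , e ← joins-injective j j′ =
      ne (cong (_ ,_) (trans (sym (m<n⇒m%n≡m lt)) (trans (≈⇒% e) (m<n⇒m%n≡m lt′))))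
    pair-of : ∀ {e} → e ∈ names (cols M) 0 n →
      ∃[ p ] p ∈ pairs × Joins (proj₁ e) (proj₂ e) (proj₁ p) (proj₂ p) × proj₂ e < n
    pair-of {k , i} e∈ with _ , lt , c ← ∈-names⁻ (cols M) 0 n e∈
      with unorderedPairs⁺ (complete (proj₁ (ends k i))) (complete (proj₂ (ends k i)))
             (λ eq → ~-irrefl eq (joins⇒~ {k} {i} (inj₁ refl)))
    ... | inj₁ p∈ = _ , ∈-filter⁺ (T? ∘ uncurry (has M)) p∈ (member⁺ M k i c) , inj₁ refl , lt
    ... | inj₂ p∈ = _ , ∈-filter⁺ (T? ∘ uncurry (has M)) p∈ (has-sym M (member⁺ M k i c)) , inj₂ refl , lt

  -- Periodic column sequences and closed paths

  suc-≈ : ∀ {i j} → i ≈ j → suc i ≈ suc j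
  suc-≈ {i} {j} e = trans (cong (_mod n) (+-comm 1 i)) (trans (+-≈ 1 e) (cong (_mod n) (+-comm j 1)))

  n+-≈ : ∀ i → n + i ≈ i
  n+-≈ i = trans (cong (_mod n) (+-comm n i)) (+n-≈ i)

  fits-periodic : ∀ {Y} → Periodic Y → ∀ {i j} → i ≈ j → Fits Y i → Fits Y j
  fits-periodic per e = subst T (cong₂ fits
    (cong₂ _,_ (cong (contains uu) (per e)) (cong₂ _,_
      (cong (contains uu) (per (suc-≈ e))) (cong (contains vv) (per (suc-≈ e)))))
    (per (suc-≈ (suc-≈ e))))

  closed⇒fits : ∀ {Y s} → Periodic Y → Path s (segment Y 0 n) s → ∀ j → Fits Y j
  closed⇒fits {Y} {s} per p j = fits-periodic per (%-≈ j)
    (path⇒fits Y 0 (n + n) twice (j % n) (+-mono-<-≤ n≥3 (<⇒≤ (m%n<n j n))))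
    where
    -- `path⇒fits` says nothing about the first two columns, so the circle is traversed twice.
    twice : Path s (segment Y 0 (n + n)) s
    twice = subst (λ cs → Path s cs s)
      (sym (trans (segment-++ Y 0 n n) (cong (segment Y 0 n ++_)
        (segment-cong n 0 n λ i _ → per (n+-≈ i)))))
      (p ++ᵖ p)

  -- `cut Y (n ∸ 2)` is the cut before column n, that is, before column 0.
  fits⇒closed : ∀ {Y} → Periodic Y → (∀ j → Fits Y j) → ∃[ s ] Path s (segment Y 0 n) s
  fits⇒closed {Y} per fits = cut Y (n ∸ 2) ,
    subst₂ (Path (cut Y (n ∸ 2)))
      (trans (cong (λ q → segment Y q n) (m+[n∸m]≡n (<⇒≤ n≥3))) (segment-cong n 0 n λ i _ → per (n+-≈ i)))
      (cong₂ _,_ (cong (contains uu) (per (+n-≈ (n ∸ 2)))) (cong₂ _,_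
        (cong (contains uu) (per (suc-≈ (+n-≈ (n ∸ 2))))) (cong (contains vv) (per (suc-≈ (+n-≈ (n ∸ 2)))))))
      (fits⇒path Y fits (n ∸ 2) n)

  repeat : List Col → ℕ → Col
  repeat cs i = nth cs (i % n)

  repeat-periodic : ∀ cs → Periodic (repeat cs)
  repeat-periodic cs e = cong (nth cs) (≈⇒% e)

  segment-repeat : ∀ {cs} → length cs ≡ n → segment (repeat cs) 0 n ≡ cs
  segment-repeat {cs} refl = trans
    (segment-cong 0 0 n λ i i<n → cong (nth cs) (m<n⇒m%n≡m i<n)) (segment-nth cs)

  segment-⊑-periodic : ∀ {Y Z} → Periodic Y → Periodic Z → segment Y 0 n ⊑ segment Z 0 n → ∀ i → Y i ≼ Z i
  segment-⊑-periodic perY perZ p i = subst₂ _≼_ (perY (%-≈ i)) (perZ (%-≈ i))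
    (segment-⊑⁻ 0 n p (i % n) (m%n<n i n))

  segment-≡-periodic : ∀ {Y Z} → Periodic Y → Periodic Z → segment Y 0 n ≡ segment Z 0 n → ∀ i → Y i ≡ Z i
  segment-≡-periodic {Y} {Z} perY perZ e i = ≼-antisym
    (segment-⊑-periodic perY perZ (subst (segment Y 0 n ⊑_) e ⊑-refl) i)
    (segment-⊑-periodic perZ perY (subst (_⊑ segment Y 0 n) e ⊑-refl) i)

  -- Forcing sets and forcing numbers on rows

  row : EdgeSet → List Col
  row M = segment (cols M) 0 n

  cols-≡⇒≐ : ∀ M N → SpokesAlone M → SpokesAlone N → (∀ i → cols M i ≡ cols N i) → M ≐ₑ N
  cols-≡⇒≐ M N aloneM aloneN e =
    ≼⇒⊆ M N aloneM (λ i k → subst (T ∘ contains k) (e i)) ,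
    ≼⇒⊆ N M aloneN (λ i k → subst (T ∘ contains k) (sym (e i)))

  ⊆⇒≼ : ∀ M N → M ⊆ₑ N → SpokesAlone N → ∀ i → cols M i ≼ cols N i
  ⊆⇒≼ M N sub alone i k c = member⁻ N alone k i (sub (member⁺ M k i c))

  -- A competing closed path, repeated periodically, is a perfect matching containing `Q`, hence
  -- equal to `M`.
  forcing⇒forces : ∀ {M Q} → IsPerfectMatching M → IsForcingSet M Q → Forces (row M) (row Q)
  forcing⇒forces {M} {Q} pm (Q⊆M , F) =
    segment-⊑⁺ 0 n (⊆⇒≼ Q M (λ {x} {y} → Q⊆M {x} {y}) (matching-alone {M} pm)) , λ s N p Q⊑N →
      let Y      = repeat N
          per    = repeat-periodic N
          len    = trans (sym (Pointwise.Pointwise-length Q⊑N)) (segment-length (cols Q) 0 n)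
          N≡     = segment-repeat len
          fits   = closed⇒fits per (subst (λ cs → Path s cs s) (sym N≡) p)
          Q≼     = segment-⊑-periodic (cols-periodic Q) per (subst (row Q ⊑_) (sym N≡) Q⊑N)
          Q⊆     = ≼⇒⊆ Q (edgeSet Y)
                     (alone-⊆ {M} {Q} (λ {x} {y} → Q⊆M {x} {y}) (matching-alone {M} pm))
                     (λ i k c → subst (λ d → T (contains k d)) (sym (cols-edgeSet Y per i)) (Q≼ i k c))
          N⊆M , M⊆N = F (edgeSet Y) (fits⇒matching per fits) (λ {x} {y} → Q⊆ {x} {y})
      in trans (sym N≡) (segment-cong 0 0 n λ i _ → trans (sym (cols-edgeSet Y per i))
           (≼-antisym (⊆⇒≼ (edgeSet Y) M (λ {x} {y} → N⊆M {x} {y}) (matching-alone {M} pm) i)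
                      (⊆⇒≼ M (edgeSet Y) (λ {x} {y} → M⊆N {x} {y}) (edgeSet-alone Y per) i)))

  forces⇒forcing : ∀ {M Q} → IsPerfectMatching M → Forces (row M) Q →
    ∃[ R ] IsForcingSet M R × card R ≡ size Q
  forces⇒forcing {M} {Q} pm (Q⊑M , F) = R , (R⊆M , forced) ,
    trans (card≡size R (edgeSet-alone Y per)) (cong size (trans (segment-cong 0 0 n λ i _ → cols-edgeSet Y per i) Q≡))
    where
    Y   = repeat Q
    R   = edgeSet Y
    per = repeat-periodic Q
    Q≡ : segment Y 0 n ≡ Q
    Q≡ = segment-repeat (trans (Pointwise.Pointwise-length Q⊑M) (segment-length (cols M) 0 n))
    R⊆M : R ⊆ₑ M
    R⊆M h = let k , i , c , j = edgeSet⁻ Y h in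
      contains⇒has M (segment-⊑-periodic per (cols-periodic M) (subst (_⊑ row M) (sym Q≡) Q⊑M) i k c) j
    forced : ∀ M′ → IsPerfectMatching M′ → R ⊆ₑ M′ → M′ ≐ₑ M
    forced M′ pm′ R⊆M′ = cols-≡⇒≐ M′ M (matching-alone {M′} pm′) (matching-alone {M} pm)
      (segment-≡-periodic (cols-periodic M′) (cols-periodic M) (F _ (row M′) (proj₂ closed) Q⊑M′))
      where
      closed = fits⇒closed (cols-periodic M′) (matching⇒fits {M′} pm′)
      Q⊑M′ : Q ⊑ row M′
      Q⊑M′ = subst (_⊑ row M′) Q≡ (segment-⊑⁺ 0 n λ i k c →
        ⊆⇒≼ R M′ (λ {x} {y} → R⊆M′ {x} {y}) (matching-alone {M′} pm′) i k
          (subst (λ d → T (contains k d)) (sym (cols-edgeSet Y per i)) c))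

  card-row : ∀ {M R} → IsPerfectMatching M → IsForcingSet M R → card R ≡ size (row R)
  card-row {M} {R} pm (R⊆M , _) =
    card≡size R (alone-⊆ {M} {R} (λ {x} {y} → R⊆M {x} {y}) (matching-alone {M} pm))

  forcingNumber⇒hasMin : ∀ {M k} → IsPerfectMatching M → HasForcingNumber M k → HasMin (row M) k
  forcingNumber⇒hasMin {M} pm ((R , F , e) , low) =
    (row R , forcing⇒forces {M} {R} pm F , trans (sym (card-row {M} {R} pm F)) e) , λ T F′ →
      let R′ , G , e′ = forces⇒forcing {M} pm F′ in ≤-trans (low R′ G) (≤-reflexive e′)

  hasMin⇒forcingNumber : ∀ {M k} → IsPerfectMatching M → HasMin (row M) k → HasForcingNumber M k
  hasMin⇒forcingNumber {M} pm ((T , F , e) , low) =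
    (let R , G , e′ = forces⇒forcing {M} pm F in R , G , trans e′ e) , λ R F′ →
      ≤-trans (low (row R) (forcing⇒forces {M} {R} pm F′)) (≤-reflexive (sym (card-row {M} {R} pm F′)))

  rotate-row : ∀ {Y k} → Periodic Y → ∀ q → HasMin (segment Y 0 n) k → HasMin (segment Y q n) k
  rotate-row per zero min = min
  rotate-row {Y} {k} per (suc q) min = subst (λ m → HasMin (segment Y (suc q) m) k) (sym n≡)
    (subst (λ cs → HasMin cs k) turn
      (rotate-hasMin (Y q ∷ []) (segment Y (suc q) (n ∸ 1))
        (subst (λ m → HasMin (segment Y q m) k) n≡ (rotate-row per q min))))
    where
    n≡ : n ≡ suc (n ∸ 1)
    n≡ = sym (m+[n∸m]≡n {1} (≤-trans (s≤s z≤n) n≥3))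
    turn : segment Y (suc q) (n ∸ 1) ++ Y q ∷ [] ≡ segment Y (suc q) (suc (n ∸ 1))
    turn = begin
      segment Y (suc q) (n ∸ 1) ++ Y q ∷ []
        ≡⟨ cong (λ c → segment Y (suc q) (n ∸ 1) ++ c ∷ []) (trans (sym (per (+n-≈ q))) (cong Y (trans (cong (q +_) n≡) (+-suc q (n ∸ 1))))) ⟩
      segment Y (suc q) (n ∸ 1) ++ segment Y (suc q + (n ∸ 1)) 1
        ≡⟨ segment-++ Y (suc q) (n ∸ 1) 1 ⟨
      segment Y (suc q) (n ∸ 1 + 1)
        ≡⟨ cong (segment Y (suc q)) (+-comm (n ∸ 1) 1) ⟩
      segment Y (suc q) (suc (n ∸ 1))
        ∎
      where open ≡-Reasoning

  -- Tilings of the given matchings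

  spoke⁺ : ∀ M i → HasSpoke M i → cols M i ≡ spoke
  spoke⁺ M i h with has M (u i) (v i)
  ... | true = refl

  spoke⁻ : ∀ M i → cols M i ≡ spoke → HasSpoke M i
  spoke⁻ M i e = member⁺ M rung i (subst (T ∘ contains rung) (sym e) _)

  Tiled : EdgeSet → Set
  Tiled M = ∃[ w ] ∃[ q ] ⟦ w ⟧ ≡ segment (cols M) q n

  n-2 : ∀ i → 2 + (i + (n ∸ 2)) ≡ i + n
  n-2 i = trans (+-comm 2 _) (trans (+-assoc i (n ∸ 2) 2) (cong (i +_) (m∸n+n≡m (<⇒≤ n≥3))))

  -- The row is read from a spoke. Were its cut crossed, no spoke could follow by `crossed`, yet the
  -- same spoke returns after n columns.
  spoked⇒tiled : ∀ M → IsPerfectMatching M → SpokedType M → Tiled M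
  spoked⇒tiled M pm ((i , spoke-i) , gaps) =
    let w , eq = tiling M-fits n j (case cut-before-spoke Yp (M-fits j) of λ
                   { (inj₁ e) → e
                   ; (inj₂ e) → contradiction Yp+n
                       (subst (λ q → Y q ≢ spoke) (trans (+-comm (n ∸ 1) (3 + j)) p+n)
                         (crossed M-fits gap (n ∸ 1) 0 (1 + j) (4 ∣0) (+-comm 1 (2 + j)) e
                           (λ k p<k k< → contradiction p<k (≤⇒≯ (s≤s⁻¹ k<))))) })
                 Yp+n
    in w , 2 + j , eq
    where
    Y = cols M
    per : Periodic Y
    per = cols-periodic M
    M-fits = matching⇒fits {M} pm
    -- Then `2 + j` is `i + n`, the given spoke one turn later.
    j = i + (n ∸ 2)
    Yp : Y (2 + j) ≡ spoke
    Yp = trans (cong Y (n-2 i)) (trans (per (+n-≈ i)) (spoke⁺ M i spoke-i))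
    Yp+n : Y (2 + j + n) ≡ spoke
    Yp+n = trans (per (+n-≈ (2 + j))) Yp
    p+n : 3 + j + (n ∸ 1) ≡ 2 + j + n
    p+n = trans (cong (_+ (n ∸ 1)) (+-comm 1 (2 + j)))
      (trans (+-assoc (2 + j) 1 (n ∸ 1)) (cong (2 + j +_) (m+[n∸m]≡n {1} (≤-trans (s≤s z≤n) n≥3))))
    gap : ∀ i → 2 + j < i → Y i ≡ spoke → (∀ k → 2 + j < k → k < i → Y k ≢ spoke) → 4 ∣ (i ∸ (2 + j) ∸ 1)
    gap i p<i Yi clear = gaps (2 + j) i
      -- The next spoke comes within one turn, because the starting spoke itself reappears there.
      ( p<i , ≮⇒≥ (λ lt → clear (2 + j + n) (m<m+n (2 + j) (≤-trans (s≤s z≤n) n≥3)) lt Yp+n)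
      , spoke⁻ M (2 + j) Yp , spoke⁻ M i Yi , λ k p<k k<i → clear k p<k k<i ∘ spoke⁺ M k )

  block-columns : ∀ {Y} q m → (∀ k → k < m → segment Y (q + 4 * k) 4 ≡ ⟦ B ∷ [] ⟧) →
    ⟦ replicate m B ⟧ ≡ segment Y q (4 * m)
  block-columns q zero f = refl
  block-columns {Y} q (suc m) f = trans
    (cong₂ _++_
      (trans (sym (f 0 z<s)) (cong (λ r → segment Y r 4) (+-identityʳ q)))
      (block-columns (q + 4) m λ k k<m →
        trans (cong (λ r → segment Y r 4) (trans (+-assoc q 4 (4 * k)) (cong (q +_) (sym (*-suc 4 k))))) (f (suc k) (s<s k<m))))
    (trans (sym (segment-++ Y q 4 (4 * m))) (cong (segment Y q) (sym (*-suc 4 m))))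

  -- The listed edges put a block into every four columns, and `block-rigid` turns this containment
  -- into equality.
  spokeless⇒tiled : ∀ M → IsPerfectMatching M → SpokelessType M → Tiled M
  spokeless⇒tiled M pm (_ , 4∣n , i , listed) = replicate (n / 4) B , i ,
    trans (block-columns i (n / 4) is-block) (cong (segment Y i) (m*[n/m]≡n 4∣n))
    where
    Y = cols M
    M-fits = matching⇒fits {M} pm
    pieces : ℕ → List (Vertex × Vertex)
    pieces k = (u (i + 4 * k)     , u (i + 4 * k + 2))
             ∷ (u (i + 4 * k + 1) , u (i + 4 * k + 3))
             ∷ (v (i + 4 * k)     , v (i + 4 * k + 1))
             ∷ (v (i + 4 * k + 2) , v (i + 4 * k + 3))
             ∷ []
    listed⁻ : ∀ k → k < n / 4 → ∀ {x y} → (x , y) ∈ pieces k → x – y ∈ₑ M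
    listed⁻ k k< {x} {y} p = Equivalence.from (listed x y) (inj₁ (∈-concatMap⁺ pieces (lose (∈-upTo⁺ k<) p)))
    contains⁺ : ∀ k q {q′} → q ≡ q′ → Member M k q → T (contains k (Y q′))
    contains⁺ k q refl = member⁻ M (matching-alone {M} pm) k q
    is-block : ∀ k → k < n / 4 → segment Y (i + 4 * k) 4 ≡ ⟦ B ∷ [] ⟧
    is-block k k< = trans shifted (proj₁ (block-rigid _ _ _ (fits⇒path Y M-fits (q + (n ∸ 2)) 4)
      (subst (⟦ B ∷ [] ⟧ ⊑_) shifted (c₀ ∷ c₁ ∷ c₂ ∷ (λ { rung () ; uu () ; vv () }) ∷ []))))
      where
      q = i + 4 * k
      shifted : segment Y q 4 ≡ segment Y (2 + (q + (n ∸ 2))) 4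
      shifted = segment-cong {Y} {Y} q (2 + (q + (n ∸ 2))) 4 λ r _ →
        cols-periodic M (sym (trans (cong (λ t → (t + r) mod n) (n-2 q)) (+-≈ r (+n-≈ q))))
      c₀ : both ≼ Y q
      c₀ rung ()
      c₀ uu _ = contains⁺ uu q refl (listed⁻ k k< (here refl))
      c₀ vv _ = contains⁺ vv q refl (listed⁻ k k< (there (there (here refl))))
      c₁ : onlyU ≼ Y (1 + q)
      c₁ vv ()
      c₁ rung ()
      c₁ uu _ = contains⁺ uu (q + 1) (+-comm q 1)
        (subst (λ t → T (has M (u (q + 1)) (u t))) (sym (+-assoc q 1 2)) (listed⁻ k k< (there (here refl))))
      c₂ : onlyV ≼ Y (2 + q)
      c₂ rung ()
      c₂ uu ()
      c₂ vv _ = contains⁺ vv (q + 2) (+-comm q 2)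
        (subst (λ t → T (has M (v (q + 2)) (v t))) (sym (+-assoc q 2 1)) (listed⁻ k k< (there (there (there (here refl))))))

  tiled⇒hasMin : ∀ {M k} → IsPerfectMatching M → Tiled M → HasForcingNumber M k →
    ∃[ w ] length ⟦ w ⟧ ≡ n × HasMin ⟦ w ⟧ k
  tiled⇒hasMin {M} {k} pm (w , q , eq) hf = w ,
    trans (cong length eq) (segment-length (cols M) q n) ,
    subst (λ cs → HasMin cs k) (sym eq) (rotate-row (cols-periodic M) q (forcingNumber⇒hasMin {M} pm hf))

  -- Matchings with spokes from tilings

  module _ (w : List Tile) (len : length ⟦ S ∷ w ⟧ ≡ n) where

    private
      Y : ℕ → Col
      Y = repeat ⟦ S ∷ w ⟧
      per : Periodic Y
      per = repeat-periodic ⟦ S ∷ w ⟧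
      Y≡ : segment Y 0 n ≡ ⟦ S ∷ w ⟧
      Y≡ = segment-repeat len
      Y-fits : ∀ j → Fits Y j
      Y-fits = closed⇒fits per (subst (λ cs → Path empty cs empty) (sym Y≡) (tiling-path (S ∷ w)))
      M : EdgeSet
      M = edgeSet Y

      Y-spoke : ∀ {i} → HasSpoke M i → Y i ≡ spoke
      Y-spoke {i} h = trans (sym (cols-edgeSet Y per i)) (spoke⁺ M i h)

      before-spoke : ∀ i → Y (suc i) ≡ spoke → ¬ T (contains uu (Y i))
      before-spoke i e with m≤n⇒m<n∨m≡n (m%n<n i n)
      ... | inj₁ lt = uncrossed (S ∷ w) (i % n) (inj₁ (trans
              (cong (nth ⟦ S ∷ w ⟧) (trans (sym (m<n⇒m%n≡m lt)) (≈⇒% (suc-≈ (%-≈ i))))) e))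
      ... | inj₂ eq = uncrossed (S ∷ w) (i % n) (inj₂ (trans eq (sym len)))

      ¬T⇒false : ∀ {b} → ¬ T b → b ≡ false
      ¬T⇒false {false} _  = refl
      ¬T⇒false {true}  ¬t = contradiction _ ¬t

      cut-after-spoke : ∀ j → Y (suc j) ≡ spoke → cut Y j ≡ empty
      cut-after-spoke j e = cong₂ _,_ (¬T⇒false (before-spoke j e))
        (cong₂ _,_ (cong (contains uu) e) (cong (contains vv) e))

      -- A walk by tiles from spoke `i` to spoke `k`: `d` columns, all in blocks, are passed and `f`
      -- remain. No spoke tile occurs on the way and `k` is not inside a block, so the walk stops
      -- exactly at `k`. The position `j` is tied to `i` only modulo n.
      gap : ∀ {i k} → Y k ≡ spoke → (∀ l → i < l → l < k → Y l ≢ spoke) →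
        ∀ f d j → 4 ∣ d → 2 + j ≈ suc i + d → cut Y j ≡ empty → f + (suc i + d) ≡ k → 4 ∣ (k ∸ i ∸ 1)
      gap {i} Yk clear zero d j 4∣d q≈ e refl = subst (4 ∣_)
        (cong (_∸ 1) (trans (sym (m+n∸m≡n i (suc d))) (cong (_∸ i) (+-suc i d)))) 4∣d
      gap {i} {k} Yk clear (suc f) d j 4∣d q≈ e k≡ with tile-at {Y} Y-fits j e
      ... | inj₁ (sp , _) = contradiction (trans (sym (per q≈)) sp)
              (clear (suc i + d) (s≤s (m≤m+n i d)) (subst (suc i + d <_) k≡ (s≤s (m≤n+m _ f))))
      ... | inj₂ (bl , e′) = continue f k≡
        where
        at : ∀ c → c + (suc i + d) ≡ k → c + (2 + j) ≈ k
        at zero    refl = q≈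
        at (suc c) refl = suc-≈ (at′ c)
          where
          at′ : ∀ c → c + (2 + j) ≈ c + (suc i + d)
          at′ zero    = q≈
          at′ (suc c) = suc-≈ (at′ c)
        inside : ∀ c → c + (suc i + d) ≡ k → ∀ {col} → Y (c + (2 + j)) ≡ col → col ≢ spoke → 4 ∣ (k ∸ i ∸ 1)
        inside c k≡ e ne = contradiction (trans (sym e) (trans (per (at c k≡)) Yk)) ne
        continue : ∀ f → suc f + (suc i + d) ≡ k → 4 ∣ (k ∸ i ∸ 1)
        continue 0 k≡ = inside 1 k≡ (cong (λ cs → nth cs 1) bl) λ ()
        continue 1 k≡ = inside 2 k≡ (cong (λ cs → nth cs 2) bl) λ ()
        continue 2 k≡ = inside 3 k≡ (cong (λ cs → nth cs 3) bl) λ ()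
        continue (suc (suc (suc f))) k≡ = gap Yk clear f (4 + d) (4 + j) (∣m∣n⇒∣m+n ∣-refl 4∣d)
          (trans (suc-≈ (suc-≈ (suc-≈ (suc-≈ q≈)))) (cong (_mod n) (sym shift))) e′
          (trans (cong (f +_) shift) (trans (+-shift f) k≡))
          where
          shift : suc i + (4 + d) ≡ 4 + (suc i + d)
          shift = trans (sym (+-assoc (suc i) 4 d)) (trans (cong (_+ d) (+-comm (suc i) 4)) (+-assoc 4 (suc i) d))
          +-shift : ∀ f → f + (4 + (suc i + d)) ≡ 4 + f + (suc i + d)
          +-shift f = trans (sym (+-assoc f 4 _)) (cong (_+ (suc i + d)) (+-comm f 4))

    matching-of-tiling : IsPerfectMatching M
    matching-of-tiling = fits⇒matching per Y-fits

    tiling-spoked : SpokedType M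
    tiling-spoked = (0 , spoke⁻ M 0 (trans (cols-edgeSet Y per 0) first)) , λ
      { i k (i<k , _ , hi , hk , clear) →
          gap (Y-spoke hk) (λ l i<l l<k e → clear l i<l l<k (spoke⁻ M l (trans (cols-edgeSet Y per l) e)))
            -- For this `j`, column `2 + j` is column `suc i` one turn later.
            (k ∸ suc i) 0 (i + (n ∸ 1)) (4 ∣0)
            (trans (cong (_mod n) (position i)) (trans (suc-≈ (+n-≈ i)) (cong (_mod n) (sym (+-identityʳ (suc i))))))
            (cut-after-spoke (i + (n ∸ 1)) (trans (cong Y (suc-injective (position i))) (trans (per (+n-≈ i)) (Y-spoke hi))))
            (trans (cong (k ∸ suc i +_) (+-identityʳ (suc i))) (m∸n+n≡m i<k)) }
      where
      first : Y 0 ≡ spoke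
      first = cong (nth ⟦ S ∷ w ⟧) (m<n⇒m%n≡m (≤-trans (s≤s z≤n) n≥3))
      position : ∀ i → 2 + (i + (n ∸ 1)) ≡ suc (i + n)
      position i = cong suc (trans (sym (+-suc i (n ∸ 1))) (cong (i +_) (m+[n∸m]≡n {1} (≤-trans (s≤s z≤n) n≥3))))

    tiling-row : row M ≡ ⟦ S ∷ w ⟧
    tiling-row = trans (segment-cong 0 0 n λ i _ → cols-edgeSet Y per i) Y≡

    tiling-spectrum : ∀ {k} → HasMin ⟦ S ∷ w ⟧ k → ForcingSpectrum₁ k
    tiling-spectrum {k} min = M , (matching-of-tiling , inj₁ (n≢4 , inj₁ tiling-spoked)) ,
      hasMin⇒forcingNumber {M} matching-of-tiling (subst (λ cs → HasMin cs k) (sym tiling-row) min)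

  continuous : Continuous ForcingSpectrum₁
  continuous t Aa Ab a<t t<b =
    let w , len , min = tiled Aa
        w′ , len′ , min′ = tiled Ab
        w″ , len″ , min″ = interpolate n≢4 {w} {w′} len len′ min min′ t a<t t<b
    in tiling-spectrum w″ len″ min″
    where
    tiled : ∀ {k} → ForcingSpectrum₁ k → ∃[ w ] length ⟦ w ⟧ ≡ n × HasMin ⟦ w ⟧ k
    tiled (M , (pm , inj₁ (_ , inj₁ spoked)) , hf)    = tiled⇒hasMin {M} pm (spoked⇒tiled M pm spoked) hf
    tiled (M , (pm , inj₁ (_ , inj₂ spokeless)) , hf) = tiled⇒hasMin {M} pm (spokeless⇒tiled M pm spokeless) hf
    tiled (M , (pm , inj₂ (n≡4 , _)) , hf)            = contradiction n≡4 n≢4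

-- The case n = 4

module Four (n≥3 : 3 ≤ 4) where

  open Petersen 4 n≥3
  open FiniteSimpleGraph P

  _≟ₑ_ : (e f : Vertex × Vertex) → Dec (e ≡ f)
  _≟ₑ_ = ×-≡-dec _≟ᵥ_ _≟ᵥ_

  edge? : ∀ (es : List (Vertex × Vertex)) x y → Dec (edgesOf es x y)
  edge? es x y = Any.any? ((x , y) ≟ₑ_) es ⊎-dec Any.any? ((y , x) ≟ₑ_) es

  singleton : ∀ e → e ∈ edgeList → EdgeSet
  singleton e e∈ = record
    { has     = λ x y → ⌊ edge? (e ∷ []) x y ⌋
    ; has-sym = λ {x} {y} h → fromWitness {a? = edge? (e ∷ []) y x}
        (⊎.swap (toWitness {a? = edge? (e ∷ []) x y} h))
    ; has⇒~   = λ {x} {y} h → case toWitness {a? = edge? (e ∷ []) x y} h of λ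
        { (inj₁ (here refl)) → inj₁ e∈ ; (inj₂ (here refl)) → inj₂ e∈ }
    }

  allVertices? : ∀ {Q : Vertex → Set} → (∀ x → Dec (Q x)) → Dec (∀ x → Q x)
  allVertices? Q? = map′ (λ { (f , g) → λ { (uᶠ i) → f i ; (vᶠ i) → g i } })
    (λ f → f ∘ uᶠ , f ∘ vᶠ) (Fin.all? (Q? ∘ uᶠ) ×-dec Fin.all? (Q? ∘ vᶠ))

  -- With `es` known to lie in a matching, every neighbour of `x` other than `t` is taken by an edge
  -- that avoids `x`, so `t` is the only partner left.
  Blocked : List (Vertex × Vertex) → Vertex → Vertex → Set
  Blocked es x t = ∀ y → x ~ y → y ≡ t ⊎ Any (λ (p , q) → (p ≡ y × q ≢ x) ⊎ (q ≡ y × p ≢ x)) es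

  blocked? : ∀ es x t → Dec (Blocked es x t)
  blocked? es x t = allVertices? λ y → edge? edgeList x y →-dec ((y ≟ᵥ t) ⊎-dec
    Any.any? (λ (p , q) → (p ≟ᵥ y ×-dec ¬? (q ≟ᵥ x)) ⊎-dec (q ≟ᵥ y ×-dec ¬? (p ≟ᵥ x))) es)

  module _ (M : EdgeSet) (pm : IsPerfectMatching M) where

    same-partner : ∀ {a b c} → a – b ∈ₑ M → a – c ∈ₑ M → b ≡ c
    same-partner {a} f g = let _ , _ , uniq = pm a in trans (sym (uniq f)) (uniq g)

    propagate : ∀ {es} → All (uncurry (λ p q → p – q ∈ₑ M)) es → ∀ {x t} → Blocked es x t → x – t ∈ₑ M
    propagate known {x} {t} blocked with y , h , _ ← pm x with blocked y (has⇒~ M h)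
    ... | inj₁ refl = h
    ... | inj₂ some with (p , q) , e∈ , clash ← find some with All.lookup known e∈ | clash
    ...   | h′ | inj₁ (refl , ne) = contradiction (same-partner h′ (has-sym M h)) ne
    ...   | h′ | inj₂ (refl , ne) = contradiction (same-partner (has-sym M h′) (has-sym M h)) ne

  -- Inclusion of one perfect matching in another is equality, by uniqueness of partners.
  forced-by-edge : ∀ M → IsPerfectMatching M → ∀ {es} → M ≐[ es ] → ∀ {e} (e∈ : e ∈ edgeList) → e ∈ es →
    (∀ M′ → IsPerfectMatching M′ → uncurry (λ p q → p – q ∈ₑ M′) e → All (uncurry (λ p q → p – q ∈ₑ M′)) es) →
    IsForcingSet M (singleton e e∈)
  forced-by-edge M pm {es} M≐ {e} e∈ e∈es all = S⊆M , λ M′ pm′ S⊆M′ →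
    let M⊆M′ : M ⊆ₑ M′
        M⊆M′ = λ {x} {y} h → case Equivalence.to (M≐ x y) h of λ
          { (inj₁ p) → All.lookup (knows M′ pm′ (λ {x} {y} → S⊆M′ {x} {y})) p
          ; (inj₂ p) → has-sym M′ (All.lookup (knows M′ pm′ (λ {x} {y} → S⊆M′ {x} {y})) p) }
    in (λ {x} {y} h → let z , h′ , _ = pm x ; _ , _ , uniq = pm′ x in
          subst (λ y → x – y ∈ₑ M) (trans (sym (uniq (M⊆M′ h′))) (uniq h)) h′) ,
       (λ {x} {y} → M⊆M′ {x} {y})
    where
    Single = singleton e e∈
    S⊆M : Single ⊆ₑ M
    S⊆M {x} {y} h = case toWitness {a? = edge? (e ∷ []) x y} h of λ
      { (inj₁ (here refl)) → Equivalence.from (M≐ x y) (inj₁ e∈es)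
      ; (inj₂ (here refl)) → Equivalence.from (M≐ x y) (inj₂ e∈es) }
    knows : ∀ M′ → IsPerfectMatching M′ → Single ⊆ₑ M′ → All (uncurry (λ p q → p – q ∈ₑ M′)) es
    knows M′ pm′ S⊆M′ = all M′ pm′ (S⊆M′ (fromWitness {a? = edge? (e ∷ []) (proj₁ e) (proj₂ e)} (inj₁ (here refl))))

  infix 4 _∈ₑ?_
  _∈ₑ?_ : ∀ e es → Dec (e ∈ es)
  _∈ₑ?_ = _∈?_ _≟ₑ_

  spoke-edge : (u 0 , v 0) ∈ edgeList
  spoke-edge = from-yes ((u 0 , v 0) ∈ₑ? edgeList)

  rim-edge : (v 0 , v 1) ∈ edgeList
  rim-edge = from-yes ((v 0 , v 1) ∈ₑ? edgeList)

  -- Inner vertices have degree two here, so a single edge propagates to the whole matching.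
  forcingNumber≤1 : ∀ {k} → ForcingSpectrum₁ k → k ≤ 1
  forcingNumber≤1 (M , (_ , inj₁ (4≢4 , _)) , _) = contradiction refl 4≢4
  forcingNumber≤1 (M , (pm , inj₂ (_ , inj₁ M≐)) , (_ , low)) =
    low (singleton _ spoke-edge) (forced-by-edge M pm M≐ spoke-edge (here refl) λ M′ pm′ h₀ →
      let h₂ = propagate M′ pm′ (h₀ ∷ []) {u 2} {v 2} (from-yes (blocked? ((u 0 , v 0) ∷ []) (u 2) (v 2)))
          known = h₀ ∷ h₂ ∷ []
          h₁ = has-sym M′ (propagate M′ pm′ known {v 1} {u 1} (from-yes (blocked? ((u 0 , v 0) ∷ (u 2 , v 2) ∷ []) (v 1) (u 1))))
          h₃ = has-sym M′ (propagate M′ pm′ known {v 3} {u 3} (from-yes (blocked? ((u 0 , v 0) ∷ (u 2 , v 2) ∷ []) (v 3) (u 3))))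
      in h₀ ∷ h₁ ∷ h₂ ∷ h₃ ∷ [])
  forcingNumber≤1 (M , (pm , inj₂ (_ , inj₂ M≐)) , (_ , low)) =
    low (singleton _ rim-edge) (forced-by-edge M pm M≐ rim-edge (there (there (here refl))) λ M′ pm′ h₀ →
      let h₁ = propagate M′ pm′ (h₀ ∷ []) {u 0} {u 2} (from-yes (blocked? ((v 0 , v 1) ∷ []) (u 0) (u 2)))
          h₂ = propagate M′ pm′ (h₀ ∷ []) {u 1} {u 3} (from-yes (blocked? ((v 0 , v 1) ∷ []) (u 1) (u 3)))
          h₃ = propagate M′ pm′ (h₀ ∷ h₁ ∷ []) {v 2} {v 3} (from-yes (blocked? ((v 0 , v 1) ∷ (u 0 , u 2) ∷ []) (v 2) (v 3)))
      in h₁ ∷ h₂ ∷ h₀ ∷ h₃ ∷ [])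

theorem3p3 : (n : ℕ) (n≥3 : 3 ≤ n) → Continuous (Petersen.ForcingSpectrum₁ n n≥3)
theorem3p3 n n≥3 with n ≟ 4
... | no n≢4   = continuous n n≥3 n≢4
-- `a < t < b` requires b to be at least 2.
... | yes refl = λ t _ b∈ a<t t<b →
  contradiction (≤-trans t<b (Four.forcingNumber≤1 n≥3 b∈)) (≤⇒≯ (≤-trans (s≤s z≤n) a<t))
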